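{- Let $n\ge 1$, let $\{P_\ell\}_{\ell=1}^{n!}$ be any enumeration of the set $\mathcal P_n$ of $n\times n$ permutation matrices, and for $A\in\mathcal D_n$ let $(\alpha_\ell,P_\ell)_{\ell=1}^{n!}$, $\alpha_\ell=\alpha_\ell(A)$, be the continuous Birkhoff decomposition of $A$ induced by this enumeration. Then: (i) each $\alpha_\ell$ is a Lipschitz continuous function from $\mathcal D_n$ to $\mathbb R$; (ii) for every $A\in\mathcal D_n$, all $\alpha_\ell(A)$ are non-negative and $\sum_{\ell=1}^{n!}\alpha_\ell(A)=1$; (iii) for every $A\in\mathcal D_n$, $A=\sum_{\ell=1}^{n!}\alpha_\ell(A)P_\ell$; (iv) for every $A\in\mathcal D_n$, at most $n^2-n+1$ of the coefficients $\alpha_\ell(A)$ are non-zero.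
   Context: $\mathcal D_n\subset\mathbb R^{n\times n}$ denotes the Birkhoff polytope, i.e. the set of $n\times n$ doubly stochastic matrices (non-negative entries, every row and every column sums to $1$), with the topology/metric inherited from Euclidean $\mathbb R^{n^2}$. $\mathcal P_n\subset\mathcal D_n$ is the set of $n\times n$ permutation matrices. Continuous Birkhoff decomposition: given an enumeration $\{P_\ell\}_{\ell=1}^{n!}$ of $\mathcal P_n$ (a fixed total order on all permutation matrices) and $A\in\mathcal D_n$, the continuous Birkhoff decomposition of $A$ induced by the enumeration is $(\alpha_\ell,P_\ell)_{\ell=1}^{n!}$, where the coefficients are defined recursively for $\ell=1,\dots,n!$ by $$\alpha_\ell=\min_{i,j}\Big\{A(i,j)-\sum_{m=1}^{\ell-1}\alpha_mP_m(i,j)\ \Big|\ P_\ell(i,j)=1\Big\}.$$ -}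

module Defs where

open import Data.Bool.Base using (if_then_else_)
open import Data.Fin.Base as Fin using (Fin)
import Data.Fin.Properties as Fin
open import Data.Fin.Permutation using (Permutation′; _⟨$⟩ʳ_)
open import Data.Fin.Subset using (Subset; _∈_; ∣_∣)
open import Data.List.Base as List using (List; []; _∷_; allFin; cartesianProduct)
open import Data.Nat.Base as ℕ using (ℕ; zero; suc)
import Data.Nat.Properties as ℕ
open import Data.Integer.Base as ℤ using (+_)
import Data.Integer.Properties as ℤ
open import Data.Product.Base using (_×_; _,_; proj₁; proj₂; ∃; Σ-syntax)
open import Data.Rational.Base as ℚ using (ℚ; 0ℚ; 1ℚ; ½)
import Data.Rational.Properties as ℚ
import Data.Rational.Unnormalised.Base as ℚᵘ
import Data.Rational.Unnormalised.Properties as ℚᵘ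
open import Data.Rational.Solver using (module +-*-Solver)
open import Data.Sum.Base using (_⊎_; inj₁; inj₂)
import Data.Vec.Functional as Vector
open import Relation.Binary.PropositionalEquality
open import Relation.Nullary using (yes; no; does)

open +-*-Solver using (solve; con; _:+_; _:-_; _:*_; :-_; _:=_)

∣-∣<⇒< : ∀ p q {ε} → ℚ.∣ p ℚ.- q ∣ ℚ.< ε → p ℚ.< q ℚ.+ ε
∣-∣<⇒< p q {ε} h = begin-strict
  p                        ≡⟨ solve 2 (λ p q → p := q :+ (p :- q)) refl p q ⟩
  q ℚ.+ (p ℚ.- q)          ≤⟨ ℚ.+-monoʳ-≤ q (p≤∣p∣ (p ℚ.- q)) ⟩
  q ℚ.+ ℚ.∣ p ℚ.- q ∣      <⟨ ℚ.+-monoʳ-< q h ⟩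
  q ℚ.+ ε                  ∎
  where
  open ℚ.≤-Reasoning
  p≤∣p∣ : ∀ p → p ℚ.≤ ℚ.∣ p ∣
  p≤∣p∣ p with ℚ.≤-total 0ℚ p
  ... | inj₁ 0≤p = ℚ.≤-reflexive (sym (ℚ.0≤p⇒∣p∣≡p 0≤p))
  ... | inj₂ p≤0 = ℚ.≤-trans p≤0 (ℚ.0≤∣p∣ p)

∣-∣-comm : ∀ p q → ℚ.∣ p ℚ.- q ∣ ≡ ℚ.∣ q ℚ.- p ∣
∣-∣-comm p q = trans (sym (ℚ.∣-p∣≡∣p∣ (p ℚ.- q)))
  (cong ℚ.∣_∣ (solve 2 (λ p q → :- (p :- q) := q :- p) refl p q))

<⇒∣-∣< : ∀ {p q ε} → p ℚ.< q ℚ.+ ε → q ℚ.< p ℚ.+ ε → ℚ.∣ p ℚ.- q ∣ ℚ.< ε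
<⇒∣-∣< {p} {q} {ε} h k with ℚ.∣p∣≡p∨∣p∣≡-p (p ℚ.- q)
... | inj₁ e = begin-strict
  ℚ.∣ p ℚ.- q ∣     ≡⟨ e ⟩
  p ℚ.- q           <⟨ ℚ.+-monoˡ-< (ℚ.- q) h ⟩
  q ℚ.+ ε ℚ.- q     ≡⟨ solve 2 (λ q ε → q :+ ε :- q := ε) refl q ε ⟩
  ε                 ∎
  where open ℚ.≤-Reasoning
... | inj₂ e = begin-strict
  ℚ.∣ p ℚ.- q ∣     ≡⟨ e ⟩
  ℚ.- (p ℚ.- q)     ≡⟨ solve 2 (λ p q → :- (p :- q) := q :- p) refl p q ⟩
  q ℚ.- p           <⟨ ℚ.+-monoˡ-< (ℚ.- p) k ⟩
  p ℚ.+ ε ℚ.- p     ≡⟨ solve 2 (λ q ε → q :+ ε :- q := ε) refl p ε ⟩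
  ε                 ∎
  where open ℚ.≤-Reasoning

*-pos : ∀ {p q} → 0ℚ ℚ.< p → 0ℚ ℚ.< q → 0ℚ ℚ.< p ℚ.* q
*-pos {p} {q} 0<p 0<q = ℚ.positive⁻¹ _ {{ℚ.pos*pos⇒pos p {{ℚ.positive 0<p}} q {{ℚ.positive 0<q}}}}

0<½ : 0ℚ ℚ.< ½
0<½ = ℚ.positive⁻¹ ½

0<1 : 0ℚ ℚ.< 1ℚ
0<1 = ℚ.positive⁻¹ 1ℚ

half+half : ∀ ε → ε ℚ.* ½ ℚ.+ ε ℚ.* ½ ≡ ε
half+half ε = solve 1 (λ e → e :* con ½ :+ e :* con ½ := e) refl ε

⊓-mono-< : ∀ {p q r s} → p ℚ.< q → r ℚ.< s → p ℚ.⊓ r ℚ.< q ℚ.⊓ s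
⊓-mono-< {p} {q} {r} {s} p<q r<s with ℚ.⊓-sel q s
... | inj₁ e = subst (p ℚ.⊓ r ℚ.<_) (sym e) (ℚ.≤-<-trans (ℚ.p⊓q≤p p r) p<q)
... | inj₂ e = subst (p ℚ.⊓ r ℚ.<_) (sym e) (ℚ.≤-<-trans (ℚ.p⊓q≤q p r) r<s)

*-mono-≤-nonNeg : ∀ {p q r s} → 0ℚ ℚ.≤ r → 0ℚ ℚ.≤ q → p ℚ.≤ q → r ℚ.≤ s →
                  p ℚ.* r ℚ.≤ q ℚ.* s
*-mono-≤-nonNeg {p} {q} {r} {s} 0≤r 0≤q p≤q r≤s = ℚ.≤-trans
  (ℚ.*-monoʳ-≤-nonNeg r {{ℚ.nonNegative 0≤r}} p≤q)
  (ℚ.*-monoˡ-≤-nonNeg q {{ℚ.nonNegative 0≤q}} r≤s)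

∣ab-cd∣≤ : ∀ a b c d {B δ} → 0ℚ ℚ.< B → 0ℚ ℚ.< δ → ℚ.∣ a ∣ ℚ.≤ B → ℚ.∣ d ∣ ℚ.≤ B →
           ℚ.∣ a ℚ.- c ∣ ℚ.< δ → ℚ.∣ b ℚ.- d ∣ ℚ.< δ →
           ℚ.∣ a ℚ.* b ℚ.- c ℚ.* d ∣ ℚ.≤ δ ℚ.* B ℚ.+ δ ℚ.* B
∣ab-cd∣≤ a b c d {B} {δ} 0<B 0<δ a≤B d≤B ac bd = begin
  ℚ.∣ a ℚ.* b ℚ.- c ℚ.* d ∣
    ≡⟨ cong ℚ.∣_∣ (solve 4 (λ a b c d → a :* b :- c :* d := (b :- d) :* a :+ (a :- c) :* d) refl a b c d) ⟩
  ℚ.∣ (b ℚ.- d) ℚ.* a ℚ.+ (a ℚ.- c) ℚ.* d ∣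
    ≤⟨ ℚ.∣p+q∣≤∣p∣+∣q∣ ((b ℚ.- d) ℚ.* a) ((a ℚ.- c) ℚ.* d) ⟩
  ℚ.∣ (b ℚ.- d) ℚ.* a ∣ ℚ.+ ℚ.∣ (a ℚ.- c) ℚ.* d ∣
    ≤⟨ ℚ.+-mono-≤ (term (b ℚ.- d) a bd a≤B) (term (a ℚ.- c) d ac d≤B) ⟩
  δ ℚ.* B ℚ.+ δ ℚ.* B ∎
  where
  open ℚ.≤-Reasoning
  term : ∀ p q → ℚ.∣ p ∣ ℚ.< δ → ℚ.∣ q ∣ ℚ.≤ B → ℚ.∣ p ℚ.* q ∣ ℚ.≤ δ ℚ.* B
  term p q h k = ℚ.≤-trans (ℚ.≤-reflexive (ℚ.∣p*q∣≡∣p∣*∣q∣ p q))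
    (*-mono-≤-nonNeg (ℚ.0≤∣p∣ q) (ℚ.<⇒≤ 0<δ) (ℚ.<⇒≤ h) k)

module _ (ε : ℚ) (0<ε : 0ℚ ℚ.< ε) {B : ℚ} (0<B : 0ℚ ℚ.< B) where

  private instance _ = ℚ.>-nonZero 0<B

  *-modulus : ℚ
  *-modulus = ε ℚ.* ½ ℚ.* ½ ℚ.* (ℚ.1/ B)

  *-modulus-pos : 0ℚ ℚ.< *-modulus
  *-modulus-pos = *-pos (*-pos (*-pos 0<ε 0<½) 0<½)
    (ℚ.positive⁻¹ _ {{ℚ.1/pos⇒pos B {{ℚ.positive 0<B}}}})

  *-modulus-< : *-modulus ℚ.* B ℚ.+ *-modulus ℚ.* B ℚ.< ε
  *-modulus-< = begin-strict
    *-modulus ℚ.* B ℚ.+ *-modulus ℚ.* B      ≡⟨ cong₂ ℚ._+_ e e ⟩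
    ε ℚ.* ½ ℚ.* ½ ℚ.+ ε ℚ.* ½ ℚ.* ½          ≡⟨ half+half (ε ℚ.* ½) ⟩
    ε ℚ.* ½                                  ≡⟨ sym (ℚ.+-identityʳ (ε ℚ.* ½)) ⟩
    ε ℚ.* ½ ℚ.+ 0ℚ                           <⟨ ℚ.+-monoʳ-< (ε ℚ.* ½) (*-pos 0<ε 0<½) ⟩
    ε ℚ.* ½ ℚ.+ ε ℚ.* ½                      ≡⟨ half+half ε ⟩
    ε                                        ∎
    where
    open ℚ.≤-Reasoning
    e : *-modulus ℚ.* B ≡ ε ℚ.* ½ ℚ.* ½
    e = trans (ℚ.*-assoc (ε ℚ.* ½ ℚ.* ½) (ℚ.1/ B) B)
      (trans (cong (ε ℚ.* ½ ℚ.* ½ ℚ.*_) (ℚ.*-inverseˡ B)) (ℚ.*-identityʳ (ε ℚ.* ½ ℚ.* ½)))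

archimedean : ∀ q → ∃ λ N → q ℚ.< (+ N) ℚ./ 1
archimedean q = suc ℤ.∣ ℚ.↥ q ∣ , ℚ.toℚᵘ-cancel-< (ℚᵘ.<-respʳ-≃
    (ℚᵘ.≃-sym (ℚ.toℚᵘ-fromℚᵘ (ℚᵘ.mkℚᵘ (+ suc ℤ.∣ ℚ.↥ q ∣) 0))) (lem q))
  where
  lem : ∀ q → ℚ.toℚᵘ q ℚᵘ.< ℚᵘ.mkℚᵘ (+ suc ℤ.∣ ℚ.↥ q ∣) 0
  lem (ℚ.mkℚ a d-1 _) = ℚᵘ.*<* (ℤ.≤-<-trans (ℤ.≤-reflexive (ℤ.*-identityʳ a))
    (bound a))
    where
    bound : ∀ a → a ℤ.< + suc ℤ.∣ a ∣ ℤ.* + suc d-1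
    bound (+ a) = ℤ.<-≤-trans (ℤ.+<+ (ℕ.n<1+n a))
      (ℤ.≤-trans (ℤ.+≤+ (ℕ.m≤m*n (suc a) (suc d-1)))
        (ℤ.≤-reflexive (ℤ.pos-* (suc a) (suc d-1))))
    bound ℤ.-[1+ a ] = ℤ.-<+

infixr 8 ½^_
½^_ : ℕ → ℚ
½^ zero  = 1ℚ
½^ suc n = (½^ n) ℚ.* ½

½^-pos : ∀ n → 0ℚ ℚ.< ½^ n
½^-pos zero    = 0<1
½^-pos (suc n) = *-pos (½^-pos n) 0<½

½^-bound : ∀ n → (+ n) ℚ./ 1 ℚ.* ½^ n ℚ.≤ 1ℚ
½^-bound n = ℚ.≤-trans
  (ℚ.*-monoʳ-≤-nonNeg (½^ n) {{ℚ.nonNegative (ℚ.<⇒≤ (½^-pos n))}}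
    (ℚ.≤-trans (ℚ.≤-reflexive (n/1≡Σ1 n)) (Σ1≤2^ n)))
  (ℚ.≤-reflexive (2^*½^ n))
  where
  Σ1 2^ : ℕ → ℚ
  Σ1 zero = 0ℚ
  Σ1 (suc n) = 1ℚ ℚ.+ Σ1 n
  2^ zero = 1ℚ
  2^ (suc n) = 2^ n ℚ.+ 2^ n
  1≤2^ : ∀ n → 1ℚ ℚ.≤ 2^ n
  1≤2^ zero = ℚ.≤-refl
  1≤2^ (suc n) = ℚ.≤-trans (ℚ.≤-trans (1≤2^ n) (ℚ.≤-reflexive (sym (ℚ.+-identityʳ _))))
    (ℚ.+-monoʳ-≤ (2^ n) (ℚ.≤-trans (ℚ.<⇒≤ 0<1) (1≤2^ n)))
  n/1≡Σ1 : ∀ n → (+ n) ℚ./ 1 ≡ Σ1 n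
  n/1≡Σ1 zero = refl
  n/1≡Σ1 (suc n) = trans (ℚ.toℚᵘ-injective (ℚᵘ.≃-trans
      (ℚ.toℚᵘ-fromℚᵘ (ℚᵘ.mkℚᵘ (+ suc n) 0))
      (ℚᵘ.≃-trans (ℚᵘ.*≡* (cong (ℤ._* (+ 1)) (sym (cong (λ k → (+ 1) ℤ.+ k) (ℤ.*-identityʳ (+ n))))))
        (ℚᵘ.≃-sym (ℚᵘ.≃-trans (ℚ.toℚᵘ-homo-+ 1ℚ (+ n ℚ./ 1))
          (ℚᵘ.+-congʳ ℚᵘ.1ℚᵘ (ℚ.toℚᵘ-fromℚᵘ (ℚᵘ.mkℚᵘ (+ n) 0))))))))
    (cong (1ℚ ℚ.+_) (n/1≡Σ1 n))
  Σ1≤2^ : ∀ n → Σ1 n ℚ.≤ 2^ n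
  Σ1≤2^ zero = ℚ.<⇒≤ 0<1
  Σ1≤2^ (suc n) = ℚ.+-mono-≤ (1≤2^ n) (Σ1≤2^ n)
  2^*½^ : ∀ n → 2^ n ℚ.* ½^ n ≡ 1ℚ
  2^*½^ zero = refl
  2^*½^ (suc n) = trans
    (solve 2 (λ a b → (a :+ a) :* (b :* con ½) := a :* b) refl (2^ n) (½^ n)) (2^*½^ n)

½^-small : ∀ B {ε} → 0ℚ ℚ.< B → 0ℚ ℚ.< ε →
           ∃ λ N → ∀ n → N ℕ.≤ n → B ℚ.* ½^ n ℚ.< ε
½^-small B {ε} 0<B 0<ε = N , λ n N≤n → begin-strict
    B ℚ.* ½^ n                       ≡⟨ sym (trans (cong (ℚ._* (B ℚ.* ½^ n)) (ℚ.*-inverseʳ ε)) (ℚ.*-identityˡ _)) ⟩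
    ε ℚ.* (ℚ.1/ ε) ℚ.* (B ℚ.* ½^ n)  ≡⟨ solve 4 (λ e i b h → e :* i :* (b :* h) := (e :* h) :* (b :* i)) refl ε (ℚ.1/ ε) B (½^ n) ⟩
    (ε ℚ.* ½^ n) ℚ.* (B ℚ.* (ℚ.1/ ε)) <⟨ ℚ.*-monoʳ-<-pos (ε ℚ.* ½^ n) {{ℚ.positive (*-pos 0<ε (½^-pos n))}} (proj₂ arch) ⟩
    (ε ℚ.* ½^ n) ℚ.* (+ N ℚ./ 1)     ≤⟨ ℚ.*-monoˡ-≤-nonNeg (ε ℚ.* ½^ n) {{ℚ.nonNegative (ℚ.<⇒≤ (*-pos 0<ε (½^-pos n)))}} (/1-mono N≤n) ⟩
    (ε ℚ.* ½^ n) ℚ.* (+ n ℚ./ 1)     ≡⟨ solve 3 (λ e h k → (e :* h) :* k := e :* (k :* h)) refl ε (½^ n) (+ n ℚ./ 1) ⟩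
    ε ℚ.* ((+ n ℚ./ 1) ℚ.* ½^ n)     ≤⟨ ℚ.*-monoˡ-≤-nonNeg ε {{ℚ.nonNegative (ℚ.<⇒≤ 0<ε)}} (½^-bound n) ⟩
    ε ℚ.* 1ℚ                         ≡⟨ ℚ.*-identityʳ ε ⟩
    ε                                ∎
  where
  open ℚ.≤-Reasoning
  instance _ = ℚ.>-nonZero 0<ε
  arch = archimedean (B ℚ.* (ℚ.1/ ε))
  N = proj₁ arch
  /1-mono : ∀ {m n} → m ℕ.≤ n → (+ m) ℚ./ 1 ℚ.≤ (+ n) ℚ./ 1
  /1-mono {m} {n} m≤n = ℚ.toℚᵘ-cancel-≤
    (ℚᵘ.≤-trans (ℚᵘ.≤-reflexive (ℚ.toℚᵘ-fromℚᵘ (ℚᵘ.mkℚᵘ (+ m) 0)))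
    (ℚᵘ.≤-trans (ℚᵘ.*≤* (ℤ.*-monoʳ-≤-nonNeg (+ 1) (ℤ.+≤+ m≤n)))
      (ℚᵘ.≤-reflexive (ℚᵘ.≃-sym (ℚ.toℚᵘ-fromℚᵘ (ℚᵘ.mkℚᵘ (+ n) 0))))))

width : ℚ → ℕ → ℚ
width q n = (1ℚ ℚ.+ q) ℚ.* ½^ n

-- For 0 ≤ q, the square root of q lies between root q n and
-- root q n + width q n.
root : ℚ → ℕ → ℚ
root q zero    = 0ℚ
root q (suc n) with (root q n ℚ.+ width q (suc n)) ℚ.* (root q n ℚ.+ width q (suc n)) ℚ.≤? q
... | yes _ = root q n ℚ.+ width q (suc n)
... | no  _ = root q n

width-pos : ∀ {q} → 0ℚ ℚ.≤ q → ∀ n → 0ℚ ℚ.< width q n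
width-pos {q} 0≤q n = *-pos (ℚ.+-mono-<-≤ 0<1 0≤q) (½^-pos n)

width-half : ∀ q n → width q (suc n) ℚ.+ width q (suc n) ≡ width q n
width-half q n = solve 2 (λ w h → w :* (h :* con ½) :+ w :* (h :* con ½) := w :* h) refl
  (1ℚ ℚ.+ q) (½^ n)

root-nonNeg : ∀ {q} → 0ℚ ℚ.≤ q → ∀ n → 0ℚ ℚ.≤ root q n
root-nonNeg 0≤q zero = ℚ.≤-refl
root-nonNeg {q} 0≤q (suc n)
  with (root q n ℚ.+ width q (suc n)) ℚ.* (root q n ℚ.+ width q (suc n)) ℚ.≤? q
... | yes _ = ℚ.+-mono-≤ (root-nonNeg 0≤q n) (ℚ.<⇒≤ (width-pos 0≤q (suc n)))
... | no  _ = root-nonNeg 0≤q n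

root²≤ : ∀ {q} → 0ℚ ℚ.≤ q → ∀ n → root q n ℚ.* root q n ℚ.≤ q
root²≤ 0≤q zero = 0≤q
root²≤ {q} 0≤q (suc n)
  with (root q n ℚ.+ width q (suc n)) ℚ.* (root q n ℚ.+ width q (suc n)) ℚ.≤? q
... | yes h = h
... | no  _ = root²≤ 0≤q n

<[root+width]² : ∀ {q} → 0ℚ ℚ.≤ q → ∀ n →
                 q ℚ.< (root q n ℚ.+ width q n) ℚ.* (root q n ℚ.+ width q n)
<[root+width]² {q} 0≤q zero = begin-strict
  q                          ≡⟨ solve 1 (λ q → q := con 0ℚ :+ q) refl q ⟩
  0ℚ ℚ.+ q                   <⟨ ℚ.+-monoˡ-< q 0<1 ⟩
  1ℚ ℚ.+ q                   ≡⟨ solve 1 (λ q → con 1ℚ :+ q := con 1ℚ :+ q :+ con 0ℚ) refl q ⟩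
  1ℚ ℚ.+ q ℚ.+ 0ℚ            ≤⟨ ℚ.+-monoʳ-≤ (1ℚ ℚ.+ q) (ℚ.≤-trans (ℚ.≤-reflexive (sym (ℚ.*-zeroˡ (1ℚ ℚ.+ q)))) (ℚ.*-monoʳ-≤-nonNeg (1ℚ ℚ.+ q) {{ℚ.nonNegative (ℚ.+-mono-≤ (ℚ.<⇒≤ 0<1) 0≤q)}} 0≤q)) ⟩
  1ℚ ℚ.+ q ℚ.+ q ℚ.* (1ℚ ℚ.+ q) ≡⟨ solve 1 (λ q → con 1ℚ :+ q :+ q :* (con 1ℚ :+ q) := (con 0ℚ :+ (con 1ℚ :+ q) :* con 1ℚ) :* (con 0ℚ :+ (con 1ℚ :+ q) :* con 1ℚ)) refl q ⟩
  (0ℚ ℚ.+ width q 0) ℚ.* (0ℚ ℚ.+ width q 0) ∎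
  where open ℚ.≤-Reasoning
<[root+width]² {q} 0≤q (suc n)
  with (root q n ℚ.+ width q (suc n)) ℚ.* (root q n ℚ.+ width q (suc n)) ℚ.≤? q
... | yes _ = subst (λ r → q ℚ.< r ℚ.* r)
  (trans (cong (root q n ℚ.+_) (sym (width-half q n)))
         (sym (ℚ.+-assoc (root q n) (width q (suc n)) (width q (suc n)))))
  (<[root+width]² 0≤q n)
... | no ≰ = ℚ.≰⇒> ≰

-- ℝ as the Cauchy sequences of rationals, identified when their
-- difference tends to 0

Cauchy : (ℕ → ℚ) → Set
Cauchy x = ∀ ε → 0ℚ ℚ.< ε →
  ∃ λ N → ∀ m n → N ℕ.≤ m → N ℕ.≤ n → ℚ.∣ x m ℚ.- x n ∣ ℚ.< ε

record ℝ : Set where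
  constructor mkℝ
  field
    seq    : ℕ → ℚ
    cauchy : Cauchy seq

open ℝ

infix 4 _≈_ _≤_

_≈_ : ℝ → ℝ → Set
x ≈ y = ∀ ε → 0ℚ ℚ.< ε →
  ∃ λ N → ∀ n → N ℕ.≤ n → ℚ.∣ seq x n ℚ.- seq y n ∣ ℚ.< ε

_≤_ : ℝ → ℝ → Set
x ≤ y = ∀ ε → 0ℚ ℚ.< ε →
  ∃ λ N → ∀ n → N ℕ.≤ n → seq x n ℚ.< seq y n ℚ.+ ε

-- By symmetry in m and n, one-sided estimates suffice.
mkCauchy : ∀ {x} →
  (∀ ε → 0ℚ ℚ.< ε → ∃ λ N → ∀ m n → N ℕ.≤ m → N ℕ.≤ n → x m ℚ.< x n ℚ.+ ε) → Cauchy x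
mkCauchy h ε 0<ε with h ε 0<ε
... | N , k = N , λ m n N≤m N≤n → <⇒∣-∣< (k m n N≤m N≤n) (k n m N≤n N≤m)

half-pos : ∀ {ε} → 0ℚ ℚ.< ε → 0ℚ ℚ.< ε ℚ.* ½
half-pos 0<ε = *-pos 0<ε 0<½

module _ (x y : ℕ → ℚ) (cx : Cauchy x) (cy : Cauchy y) where

  common : ∀ δ → 0ℚ ℚ.< δ → ∃ λ N → ∀ m n → N ℕ.≤ m → N ℕ.≤ n →
           ℚ.∣ x m ℚ.- x n ∣ ℚ.< δ × ℚ.∣ y m ℚ.- y n ∣ ℚ.< δ
  common δ 0<δ with cx δ 0<δ | cy δ 0<δ
  ... | M , f | N , g = M ℕ.⊔ N , λ m n m≥ n≥ →
    f m n (ℕ.m⊔n≤o⇒m≤o M N m≥) (ℕ.m⊔n≤o⇒m≤o M N n≥) ,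
    g m n (ℕ.m⊔n≤o⇒n≤o M N m≥) (ℕ.m⊔n≤o⇒n≤o M N n≥)

  +-cauchy : Cauchy (λ n → x n ℚ.+ y n)
  +-cauchy = mkCauchy λ ε 0<ε → let N , f = common (ε ℚ.* ½) (half-pos 0<ε) in
    N , λ m n N≤m N≤n → let p , q = f m n N≤m N≤n in begin-strict
      x m ℚ.+ y m <⟨ ℚ.+-mono-< (∣-∣<⇒< (x m) (x n) p) (∣-∣<⇒< (y m) (y n) q) ⟩
      (x n ℚ.+ ε ℚ.* ½) ℚ.+ (y n ℚ.+ ε ℚ.* ½)
        ≡⟨ solve 3 (λ a b e → (a :+ e :* con ½) :+ (b :+ e :* con ½) := a :+ b :+ e) refl (x n) (y n) ε ⟩
      x n ℚ.+ y n ℚ.+ ε ∎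
    where open ℚ.≤-Reasoning

  ⊓-cauchy : Cauchy (λ n → x n ℚ.⊓ y n)
  ⊓-cauchy = mkCauchy λ ε 0<ε → let N , f = common ε 0<ε in
    N , λ m n N≤m N≤n → let p , q = f m n N≤m N≤n in begin-strict
      x m ℚ.⊓ y m                        <⟨ ⊓-mono-< (∣-∣<⇒< (x m) (x n) p) (∣-∣<⇒< (y m) (y n) q) ⟩
      (x n ℚ.+ ε) ℚ.⊓ (y n ℚ.+ ε)        ≡⟨ sym (ℚ.mono-≤-distrib-⊓ (ℚ.+-monoˡ-≤ ε) (x n) (y n)) ⟩
      x n ℚ.⊓ y n ℚ.+ ε                  ∎
    where open ℚ.≤-Reasoning

  bounded : ∃ λ B → 0ℚ ℚ.< B × ∃ λ N → ∀ n → N ℕ.≤ n → ℚ.∣ x n ∣ ℚ.≤ B × ℚ.∣ y n ∣ ℚ.≤ B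
  bounded with common 1ℚ 0<1
  ... | N , f = B , ℚ.+-mono-<-≤ 0<1 (ℚ.+-mono-≤ (ℚ.0≤∣p∣ (x N)) (ℚ.0≤∣p∣ (y N))) , N ,
    λ n N≤n → let p , q = f n N N≤n ℕ.≤-refl in
      ℚ.≤-trans (near (x n) (x N) p) (ℚ.+-monoʳ-≤ 1ℚ
        (ℚ.≤-trans (ℚ.≤-reflexive (sym (ℚ.+-identityʳ ℚ.∣ x N ∣))) (ℚ.+-monoʳ-≤ ℚ.∣ x N ∣ (ℚ.0≤∣p∣ (y N))))) ,
      ℚ.≤-trans (near (y n) (y N) q) (ℚ.+-monoʳ-≤ 1ℚ
        (ℚ.≤-trans (ℚ.≤-reflexive (sym (ℚ.+-identityˡ ℚ.∣ y N ∣))) (ℚ.+-monoˡ-≤ ℚ.∣ y N ∣ (ℚ.0≤∣p∣ (x N)))))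
    where
    B = 1ℚ ℚ.+ (ℚ.∣ x N ∣ ℚ.+ ℚ.∣ y N ∣)
    near : ∀ a b → ℚ.∣ a ℚ.- b ∣ ℚ.< 1ℚ → ℚ.∣ a ∣ ℚ.≤ 1ℚ ℚ.+ ℚ.∣ b ∣
    near a b h = ℚ.≤-trans
      (ℚ.≤-reflexive (cong ℚ.∣_∣ (solve 2 (λ a b → a := (a :- b) :+ b) refl a b)))
      (ℚ.≤-trans (ℚ.∣p+q∣≤∣p∣+∣q∣ (a ℚ.- b) b) (ℚ.+-monoˡ-≤ ℚ.∣ b ∣ (ℚ.<⇒≤ h)))

  *-cauchy : Cauchy (λ n → x n ℚ.* y n)
  *-cauchy ε 0<ε = M ℕ.⊔ N , λ m n m≥ n≥ →
      let p , q = proj₂ close m n (ℕ.m⊔n≤o⇒n≤o M N m≥) (ℕ.m⊔n≤o⇒n≤o M N n≥) in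
      ℚ.≤-<-trans
        (∣ab-cd∣≤ (x m) (y m) (x n) (y n) 0<B (*-modulus-pos ε 0<ε 0<B)
          (proj₁ (b m (ℕ.m⊔n≤o⇒m≤o M N m≥))) (proj₂ (b n (ℕ.m⊔n≤o⇒m≤o M N n≥))) p q)
        (*-modulus-< ε 0<ε 0<B)
    where
    0<B = proj₁ (proj₂ bounded)
    M = proj₁ (proj₂ (proj₂ bounded))
    b = proj₂ (proj₂ (proj₂ bounded))
    close = common (*-modulus ε 0<ε 0<B) (*-modulus-pos ε 0<ε 0<B)
    N = proj₁ close

-‿cauchy : ∀ x → Cauchy x → Cauchy (λ n → ℚ.- x n)
-‿cauchy x cx ε 0<ε with cx ε 0<ε
... | N , f = N , λ m n N≤m N≤n → subst (ℚ._< ε)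
  (trans (∣-∣-comm (x m) (x n))
    (cong ℚ.∣_∣ (solve 2 (λ a b → b :- a := :- a :- :- b) refl (x m) (x n))))
  (f m n N≤m N≤n)

∣∣-cauchy : ∀ x → Cauchy x → Cauchy (λ n → ℚ.∣ x n ∣)
∣∣-cauchy x cx = mkCauchy λ ε 0<ε → let N , f = cx ε 0<ε in
  N , λ m n N≤m N≤n → begin-strict
    ℚ.∣ x m ∣                        ≡⟨ cong ℚ.∣_∣ (solve 2 (λ a b → a := b :+ (a :- b)) refl (x m) (x n)) ⟩
    ℚ.∣ x n ℚ.+ (x m ℚ.- x n) ∣      ≤⟨ ℚ.∣p+q∣≤∣p∣+∣q∣ (x n) (x m ℚ.- x n) ⟩
    ℚ.∣ x n ∣ ℚ.+ ℚ.∣ x m ℚ.- x n ∣  <⟨ ℚ.+-monoʳ-< ℚ.∣ x n ∣ (f m n N≤m N≤n) ⟩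
    ℚ.∣ x n ∣ ℚ.+ ε                  ∎
  where open ℚ.≤-Reasoning

module _ (x : ℕ → ℚ) (cx : Cauchy x) where

  ⁺-cauchy : Cauchy (λ n → x n ℚ.⊔ 0ℚ)
  ⁺-cauchy = mkCauchy λ ε 0<ε → let N , f = cx ε 0<ε in
    N , λ m n N≤m N≤n → ⁺-split ε 0<ε (x m) (x n) (∣-∣<⇒< (x m) (x n) (f m n N≤m N≤n)) (ℚ.⊔-sel (x m) 0ℚ)
    where
    open ℚ.≤-Reasoning
    ⁺-split : ∀ ε → 0ℚ ℚ.< ε → ∀ a b → a ℚ.< b ℚ.+ ε → a ℚ.⊔ 0ℚ ≡ a ⊎ a ℚ.⊔ 0ℚ ≡ 0ℚ →
            a ℚ.⊔ 0ℚ ℚ.< b ℚ.⊔ 0ℚ ℚ.+ ε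
    ⁺-split ε 0<ε a b h (inj₁ e) = begin-strict
      a ℚ.⊔ 0ℚ        ≡⟨ e ⟩
      a               <⟨ h ⟩
      b ℚ.+ ε         ≤⟨ ℚ.+-monoˡ-≤ ε (ℚ.p≤p⊔q b 0ℚ) ⟩
      b ℚ.⊔ 0ℚ ℚ.+ ε  ∎
    ⁺-split ε 0<ε a b h (inj₂ e) = begin-strict
      a ℚ.⊔ 0ℚ        ≡⟨ e ⟩
      0ℚ              <⟨ ℚ.+-mono-≤-< (ℚ.p≤q⊔p b 0ℚ) 0<ε ⟩
      b ℚ.⊔ 0ℚ ℚ.+ ε  ∎

  root-cauchy : (∀ n → 0ℚ ℚ.≤ x n) → Cauchy (λ n → root (x n) n)
  root-cauchy 0≤x = mkCauchy main
    where
    open ℚ.≤-Reasoning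
    main : ∀ ε → 0ℚ ℚ.< ε → ∃ λ N → ∀ m n → N ℕ.≤ m → N ℕ.≤ n →
           root (x m) m ℚ.< root (x n) n ℚ.+ ε
    main ε 0<ε = M ℕ.⊔ (N₁ ℕ.⊔ N₂) , λ m n m≥ n≥ → ℚ.≰⇒> λ far →
      let m≥₁ = ℕ.m⊔n≤o⇒m≤o N₁ N₂ (ℕ.m⊔n≤o⇒n≤o M (N₁ ℕ.⊔ N₂) m≥)
          n≥₁ = ℕ.m⊔n≤o⇒m≤o N₁ N₂ (ℕ.m⊔n≤o⇒n≤o M (N₁ ℕ.⊔ N₂) n≥)
          n≥₂ = ℕ.m⊔n≤o⇒n≤o N₁ N₂ (ℕ.m⊔n≤o⇒n≤o M (N₁ ℕ.⊔ N₂) n≥)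
          xn≤B = ℚ.≤-trans (ℚ.≤-reflexive (sym (ℚ.0≤p⇒∣p∣≡p (0≤x n))))
                           (proj₁ (b n (ℕ.m⊔n≤o⇒m≤o M (N₁ ℕ.⊔ N₂) n≥)))
          narrow = ℚ.≤-<-trans
            (ℚ.*-monoʳ-≤-nonNeg (½^ n) {{ℚ.nonNegative (ℚ.<⇒≤ (½^-pos n))}} (ℚ.+-monoʳ-≤ 1ℚ xn≤B))
            (proj₂ small n n≥₂)
      in ℚ.<-irrefl refl (chain m n far narrow (∣-∣<⇒< (x m) (x n) (proj₂ close m n m≥₁ n≥₁)))
      where
      η = ε ℚ.* ½
      0<η : 0ℚ ℚ.< η
      0<η = half-pos 0<ε
      B = proj₁ (bounded x x cx cx)
      0<B = proj₁ (proj₂ (bounded x x cx cx))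
      M = proj₁ (proj₂ (proj₂ (bounded x x cx cx)))
      b = proj₂ (proj₂ (proj₂ (bounded x x cx cx)))
      close = cx (η ℚ.* η) (*-pos 0<η 0<η)
      N₁ = proj₁ close
      small = ½^-small (1ℚ ℚ.+ B) (ℚ.+-mono-< 0<1 0<B) 0<η
      N₂ = proj₁ small
      chain : ∀ m n →
        root (x n) n ℚ.+ ε ℚ.≤ root (x m) m →
        width (x n) n ℚ.< η →
        x m ℚ.< x n ℚ.+ η ℚ.* η →
        x m ℚ.< x m
      chain m n far narrow x-close = begin-strict
        x m              <⟨ x-close ⟩
        x n ℚ.+ η ℚ.* η  <⟨ ℚ.+-monoˡ-< (η ℚ.* η) (<[root+width]² (0≤x n) n) ⟩
        h ℚ.* h ℚ.+ η ℚ.* η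
          ≡⟨ sym (ℚ.+-identityʳ _) ⟩
        h ℚ.* h ℚ.+ η ℚ.* η ℚ.+ 0ℚ
          <⟨ ℚ.+-monoʳ-< (h ℚ.* h ℚ.+ η ℚ.* η) (ℚ.+-mono-< (*-pos 0<h 0<η) (*-pos 0<h 0<η)) ⟩
        h ℚ.* h ℚ.+ η ℚ.* η ℚ.+ (h ℚ.* η ℚ.+ h ℚ.* η)
          ≡⟨ solve 2 (λ h e → h :* h :+ e :* e :+ (h :* e :+ h :* e) := (h :+ e) :* (h :+ e)) refl h η ⟩
        (h ℚ.+ η) ℚ.* (h ℚ.+ η)
          ≤⟨ *-mono-≤-nonNeg (ℚ.<⇒≤ (ℚ.+-mono-< 0<h 0<η)) (root-nonNeg (0≤x m) m) h+η≤ h+η≤ ⟩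
        root (x m) m ℚ.* root (x m) m
          ≤⟨ root²≤ (0≤x m) m ⟩
        x m ∎
        where
        h = root (x n) n ℚ.+ width (x n) n
        0<h : 0ℚ ℚ.< h
        0<h = ℚ.+-mono-≤-< (root-nonNeg (0≤x n) n) (width-pos (0≤x n) n)
        h+η≤ : h ℚ.+ η ℚ.≤ root (x m) m
        h+η≤ = begin
          h ℚ.+ η                          ≤⟨ ℚ.+-monoˡ-≤ η (ℚ.+-monoʳ-≤ (root (x n) n) (ℚ.<⇒≤ narrow)) ⟩
          root (x n) n ℚ.+ η ℚ.+ η         ≡⟨ ℚ.+-assoc (root (x n) n) η η ⟩
          root (x n) n ℚ.+ (η ℚ.+ η)       ≡⟨ cong (root (x n) n ℚ.+_) (half+half ε) ⟩
          root (x n) n ℚ.+ ε               ≤⟨ far ⟩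
          root (x m) m                     ∎

infixl 6 _+_ _-_
infixl 7 _*_ _⊓_
infix  8 -_

-- Abstract, because normalising these proofs makes type checking very slow.
abstract
  fromℚ-cauchy : ∀ q → Cauchy (λ _ → q)
  fromℚ-cauchy q = mkCauchy λ ε 0<ε → 0 , λ _ _ _ _ →
    ℚ.≤-<-trans (ℚ.≤-reflexive (sym (ℚ.+-identityʳ q))) (ℚ.+-monoʳ-< q 0<ε)

  cauchy-+ : ∀ x y → Cauchy (λ n → seq x n ℚ.+ seq y n)
  cauchy-+ x y = +-cauchy (seq x) (seq y) (cauchy x) (cauchy y)

  cauchy-* : ∀ x y → Cauchy (λ n → seq x n ℚ.* seq y n)
  cauchy-* x y = *-cauchy (seq x) (seq y) (cauchy x) (cauchy y)

  cauchy-⊓ : ∀ x y → Cauchy (λ n → seq x n ℚ.⊓ seq y n)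
  cauchy-⊓ x y = ⊓-cauchy (seq x) (seq y) (cauchy x) (cauchy y)

  cauchy-neg : ∀ x → Cauchy (λ n → ℚ.- seq x n)
  cauchy-neg x = -‿cauchy (seq x) (cauchy x)

  cauchy-abs : ∀ x → Cauchy (λ n → ℚ.∣ seq x n ∣)
  cauchy-abs x = ∣∣-cauchy (seq x) (cauchy x)

  cauchy-√ : ∀ x → Cauchy (λ n → root (seq x n ℚ.⊔ 0ℚ) n)
  cauchy-√ x = root-cauchy (λ n → seq x n ℚ.⊔ 0ℚ) (⁺-cauchy (seq x) (cauchy x))
    (λ n → ℚ.p≤q⊔p (seq x n) 0ℚ)

0ℝ 1ℝ : ℝ
0ℝ = mkℝ (λ _ → 0ℚ) (fromℚ-cauchy 0ℚ)
1ℝ = mkℝ (λ _ → 1ℚ) (fromℚ-cauchy 1ℚ)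

_+_ _*_ _⊓_ : ℝ → ℝ → ℝ
x + y = mkℝ (λ n → seq x n ℚ.+ seq y n) (cauchy-+ x y)
x * y = mkℝ (λ n → seq x n ℚ.* seq y n) (cauchy-* x y)
x ⊓ y = mkℝ (λ n → seq x n ℚ.⊓ seq y n) (cauchy-⊓ x y)

-_ abs √_ : ℝ → ℝ
-_ x  = mkℝ (λ n → ℚ.- seq x n) (cauchy-neg x)
abs x = mkℝ (λ n → ℚ.∣ seq x n ∣) (cauchy-abs x)

-- Total: √ x is the square root of the positive part of x.
√ x   = mkℝ (λ n → root (seq x n ℚ.⊔ 0ℚ) n) (cauchy-√ x)

_-_ : ℝ → ℝ → ℝ
x - y = x + (- y)

∑ : ∀ {n} → (Fin n → ℝ) → ℝ
∑ = Vector.foldr _+_ 0ℝ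

-- The value at [] is junk; only nonempty lists matter.
minimum : List ℝ → ℝ
minimum []       = 0ℝ
minimum (x ∷ xs) = List.foldr _⊓_ x xs

Matrix : ℕ → Set
Matrix n = Fin n → Fin n → ℝ

record DoublyStochastic {n} (A : Matrix n) : Set where
  field
    nonNegative : ∀ i j → 0ℝ ≤ A i j
    rowSum      : ∀ i → ∑ (λ j → A i j) ≈ 1ℝ
    columnSum   : ∀ j → ∑ (λ i → A i j) ≈ 1ℝ

𝒟 : ℕ → Set
𝒟 n = Σ[ A ∈ Matrix n ] DoublyStochastic A

-- The Euclidean distance of ℝ^(n²).
distance : ∀ {n} → Matrix n → Matrix n → ℝ
distance A B = √ ∑ λ i → ∑ λ j → (A i j - B i j) * (A i j - B i j)

LipschitzContinuous : ∀ {n} → (𝒟 n → ℝ) → Set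
LipschitzContinuous f = ∃ λ L → 0ℝ ≤ L ×
  (∀ A B → abs (f A - f B) ≤ L * distance (proj₁ A) (proj₁ B))

permutationMatrix : ∀ {n} → Permutation′ n → Matrix n
permutationMatrix π i j = if does (π ⟨$⟩ʳ i Fin.≟ j) then 1ℝ else 0ℝ

-- The positions (i , j) at which permutationMatrix π has entry 1.
ones : ∀ {n} → Permutation′ n → List (Fin n × Fin n)
ones {n} π = List.filter (λ (i , j) → π ⟨$⟩ʳ i Fin.≟ j)
  (cartesianProduct (allFin n) (allFin n))

module _ {n N} (P : Fin N → Permutation′ n) (A : Matrix n) where

  -- partialSum k is the sum of α m · P m over m < k, and
  -- coefficientAt k is α k; indices start at 0.
  partialSum    : ∀ k → .(k ℕ.≤ N) → Matrix n
  coefficientAt : ∀ k → .(k ℕ.< N) → ℝ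

  partialSum zero    _   i j = 0ℝ
  partialSum (suc k) k<N i j =
    partialSum k (ℕ.<⇒≤ k<N) i j
      + coefficientAt k k<N * permutationMatrix (P (Fin.fromℕ< k<N)) i j

  coefficientAt k k<N = minimum (List.map
    (λ (i , j) → A i j - partialSum k (ℕ.<⇒≤ k<N) i j)
    (ones (P (Fin.fromℕ< k<N))))

  coefficient : Fin N → ℝ
  coefficient ℓ = coefficientAt (Fin.toℕ ℓ) (Fin.toℕ<n ℓ)

-- Stated without deciding membership: every subset all of whose elements
-- satisfy Q has at most k elements.
AtMost : ℕ → ∀ {N} → (Fin N → Set) → Set
AtMost k {N} Q = ∀ (S : Subset N) → (∀ ℓ → ℓ ∈ S → Q ℓ) → ∣ S ∣ ℕ.≤ k

{-# OPTIONS --safe #-}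

-- Reals are Cauchy sequences of rationals with pointwise operations, so the
-- t-th term of each coefficient is the result of running the recursion on the
-- rational matrix of t-th terms of A.  That matrix is only approximately doubly
-- stochastic, but it lies close to a rational matrix with exactly equal line
-- sums, and the coefficients are Lipschitz in the matrix; hence it suffices to
-- treat exact rational matrices, where order is decidable.
--
-- There, step ℓ creates a zero of the residual on the positions of P ℓ, and
-- zeros persist.  If the final residual had positive line sums, it would have a
-- permutation with positive entries, which is some P ℓ: a contradiction.  When a
-- positive coefficient is chosen, the residual has at least n positive entries
-- and loses at least one of them, hence the bound n * n - n + 1.
--
-- The positive permutation is found by induction on n.  Remove row 0 and a
-- column j with R 0 j > 0, rerouting the mass of i → j and 0 → k to i → k.  The
-- rerouted mass is smaller than the line sum, so among the permutations in a
-- decomposition of the contracted matrix one avoids the entries that are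
-- positive only by rerouting.
module Submission where

open import Defs
open import Algebra.Bundles using (CommutativeRing)
open import Data.Bool.Base using (true; false; if_then_else_)
open import Data.Empty using (⊥-elim)
open import Data.Fin.Base as Fin using (Fin; zero; suc; punchIn)
import Data.Fin.Properties as Fin
open import Data.Fin.Permutation as Permutation using (Permutation′; _⟨$⟩ʳ_; _⟨$⟩ˡ_)
open import Data.Fin.Subset using (Subset; _∈_; ∣_∣; inside)
open import Data.Fin.Subset.Properties using (_∈?_)
open import Data.List.Base as List using ([]; _∷_; cartesianProduct; allFin)
open import Data.List.Membership.Propositional renaming (_∈_ to _∈ˡ_) using ()
open import Data.List.Membership.Propositional.Properties
  using (∈-map⁺; ∈-map⁻; ∈-filter⁺; ∈-filter⁻; ∈-cartesianProduct⁺; ∈-allFin)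
open import Data.List.Relation.Unary.Any using (here; there)
open import Data.Nat.Base as ℕ using (ℕ; zero; suc; _!; _∸_)
import Data.Nat.Properties as ℕ
open import Data.Product.Base using (_×_; _,_; proj₁; proj₂; ∃)
open import Data.Rational.Base as ℚ using (ℚ; 0ℚ; 1ℚ; ½)
import Data.Rational.Properties as ℚ
open import Data.Rational.Solver using (module +-*-Solver)
open import Data.Sum.Base using (inj₁; inj₂; [_,_]′)
open import Data.Vec.Base using ([]; _∷_; here; there)
open import Effect.Monad using (RawMonad)
open import Function.Base using (_∘_)
open import Function.Definitions using (Bijective)
open import Relation.Binary.PropositionalEquality
open import Relation.Nullary using (¬_; yes; no; does; Dec)
open import Relation.Nullary.Decidable using (dec-true; dec-false; decidable-stable)
open import Relation.Nullary.Negation using (¬¬-Monad; ¬¬-map)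

open import Algebra.Properties.Semiring.Sum (CommutativeRing.semiring ℚ.+-*-commutativeRing)
  using (sum; sum-remove; sum-cong-≗; sum-replicate-zero; ∑-comm; ∑-distrib-+; *-distribˡ-sum; *-distribʳ-sum)
import Algebra.Properties.CommutativeMonoid.Sum ℕ.+-0-commutativeMonoid as ℕΣ
open +-*-Solver using (solve; con; _:+_; _:-_; _:*_; :-_; _:=_)
open ℝ

-- Order and finite sums of rationals

≤-from-gap : ∀ {p q} g → 0ℚ ℚ.≤ g → p ℚ.+ g ≡ q → p ℚ.≤ q
≤-from-gap {p} g 0≤g refl =
  subst (ℚ._≤ p ℚ.+ g) (ℚ.+-identityʳ p) (ℚ.+-monoʳ-≤ p 0≤g)

-- Together with `≤-from-gap` this turns an inequality between polynomial expressions into a ring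
-- identity for the solver.
gap : ∀ {p q} → p ℚ.≤ q → 0ℚ ℚ.≤ q ℚ.- p
gap {p} {q} p≤q = subst (ℚ._≤ q ℚ.- p) (ℚ.+-inverseʳ p) (ℚ.+-monoˡ-≤ (ℚ.- p) p≤q)

<-from-gap : ∀ {p q} g → 0ℚ ℚ.< g → p ℚ.+ g ≡ q → p ℚ.< q
<-from-gap {p} g 0<g refl =
  subst (ℚ._< p ℚ.+ g) (ℚ.+-identityʳ p) (ℚ.+-monoʳ-< p 0<g)

0≤+ : ∀ {p q} → 0ℚ ℚ.≤ p → 0ℚ ℚ.≤ q → 0ℚ ℚ.≤ p ℚ.+ q
0≤+ = ℚ.+-mono-≤

0≤* : ∀ {p q} → 0ℚ ℚ.≤ p → 0ℚ ℚ.≤ q → 0ℚ ℚ.≤ p ℚ.* q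
0≤* {p} {q} 0≤p 0≤q =
  subst (ℚ._≤ p ℚ.* q) (ℚ.*-zeroʳ p) (ℚ.*-monoˡ-≤-nonNeg p {{ℚ.nonNegative 0≤p}} 0≤q)

0≤1 : 0ℚ ℚ.≤ 1ℚ
0≤1 = ℚ.<⇒≤ 0<1

sum-mono : ∀ {n} {f g : Fin n → ℚ} → (∀ i → f i ℚ.≤ g i) → sum f ℚ.≤ sum g
sum-mono {zero}  h = ℚ.≤-refl
sum-mono {suc n} h = ℚ.+-mono-≤ (h zero) (sum-mono (h ∘ suc))

sum-nonNeg : ∀ {n} {f : Fin n → ℚ} → (∀ i → 0ℚ ℚ.≤ f i) → 0ℚ ℚ.≤ sum f
sum-nonNeg {n} {f} h = subst (ℚ._≤ sum f) (sum-replicate-zero n) (sum-mono h)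

sum-sub : ∀ {n} (f g : Fin n → ℚ) → sum (λ i → f i ℚ.- g i) ≡ sum f ℚ.- sum g
sum-sub {zero}  f g = refl
sum-sub {suc n} f g = trans (cong (f zero ℚ.- g zero ℚ.+_) (sum-sub (f ∘ suc) (g ∘ suc)))
  (solve 4 (λ a b c d → a :- b :+ (c :- d) := a :+ c :- (b :+ d)) refl
    (f zero) (g zero) (sum (f ∘ suc)) (sum (g ∘ suc)))

term≤sum : ∀ {n} {f : Fin n → ℚ} → (∀ i → 0ℚ ℚ.≤ f i) → ∀ i → f i ℚ.≤ sum f
term≤sum {suc n} {f} 0≤f i = ≤-from-gap _ (sum-nonNeg (0≤f ∘ punchIn i)) (sym (sum-remove {i = i} f))

sum-single : ∀ {n} (f : Fin n → ℚ) k → (∀ j → j ≢ k → f j ≡ 0ℚ) → sum f ≡ f k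
sum-single {suc n} f k h = begin
  sum f                          ≡⟨ sum-remove {i = k} f ⟩
  f k ℚ.+ sum (f ∘ punchIn k)    ≡⟨ cong (f k ℚ.+_) (trans
                                      (sum-cong-≗ (λ j → h _ (Fin.punchInᵢ≢i k j)))
                                      (sum-replicate-zero n)) ⟩
  f k ℚ.+ 0ℚ                     ≡⟨ ℚ.+-identityʳ (f k) ⟩
  f k                            ∎
  where open ≡-Reasoning

sum-positive : ∀ {n} (f : Fin n → ℚ) → 0ℚ ℚ.< sum f → ∃ λ i → 0ℚ ℚ.< f i
sum-positive {n} f 0<Σ with Fin.any? (λ i → 0ℚ ℚ.<? f i)
... | yes h = h
... | no ¬h = ⊥-elim (ℚ.<-irrefl refl (ℚ.<-≤-trans 0<Σ
  (subst (sum f ℚ.≤_) (sum-replicate-zero n) (sum-mono λ i → ℚ.≮⇒≥ λ 0<fi → ¬h (i , 0<fi)))))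

argmin : ∀ {n} (f : Fin (suc n) → ℚ) → ∃ λ i → ∀ j → f i ℚ.≤ f j
argmin {zero}  f = zero , λ { zero → ℚ.≤-refl }
argmin {suc n} f with argmin (f ∘ suc)
... | i , h with ℚ.≤-total (f zero) (f (suc i))
...   | inj₁ le = zero , λ { zero → ℚ.≤-refl ; (suc j) → ℚ.≤-trans le (h j) }
...   | inj₂ ge = suc i , λ { zero → ge ; (suc j) → h j }

ℕsum-mono : ∀ {n} {f g : Fin n → ℕ} → (∀ i → f i ℕ.≤ g i) → ℕΣ.sum f ℕ.≤ ℕΣ.sum g
ℕsum-mono {zero}  h = ℕ.z≤n
ℕsum-mono {suc n} h = ℕ.+-mono-≤ (h zero) (ℕsum-mono (h ∘ suc))

ℕsum-mono-< : ∀ {n} {f g : Fin n → ℕ} → (∀ i → f i ℕ.≤ g i) → ∀ i → f i ℕ.< g i →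
              ℕΣ.sum f ℕ.< ℕΣ.sum g
ℕsum-mono-< h zero    lt = ℕ.+-mono-<-≤ lt (ℕsum-mono (h ∘ suc))
ℕsum-mono-< h (suc i) lt = ℕ.+-mono-≤-< (h zero) (ℕsum-mono-< (h ∘ suc) i lt)

-- Rational matrices and multiples of permutation matrices

Matrixℚ : ℕ → Set
Matrixℚ n = Fin n → Fin n → ℚ

NonNegative : ∀ {n} → Matrixℚ n → Set
NonNegative R = ∀ i j → 0ℚ ℚ.≤ R i j

LineSums : ∀ {n} → Matrixℚ n → ℚ → Set
LineSums R s = (∀ i → sum (R i) ≡ s) × (∀ j → sum (λ i → R i j) ≡ s)

δ : ∀ {n} → Permutation′ n → Matrixℚ n
δ π i j = if does (π ⟨$⟩ʳ i Fin.≟ j) then 1ℚ else 0ℚ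

δ-on : ∀ {n} (π : Permutation′ n) i {j} → π ⟨$⟩ʳ i ≡ j → δ π i j ≡ 1ℚ
δ-on π i {j} e rewrite dec-true (π ⟨$⟩ʳ i Fin.≟ j) e = refl

δ-off : ∀ {n} (π : Permutation′ n) i {j} → π ⟨$⟩ʳ i ≢ j → δ π i j ≡ 0ℚ
δ-off π i {j} e rewrite dec-false (π ⟨$⟩ʳ i Fin.≟ j) e = refl

δ-nonNeg : ∀ {n} (π : Permutation′ n) → NonNegative (δ π)
δ-nonNeg π i j with does (π ⟨$⟩ʳ i Fin.≟ j)
... | true  = 0≤1
... | false = ℚ.≤-refl

δ≤1 : ∀ {n} (π : Permutation′ n) i j → δ π i j ℚ.≤ 1ℚ
δ≤1 π i j with does (π ⟨$⟩ʳ i Fin.≟ j)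
... | true  = ℚ.≤-refl
... | false = 0≤1

sum-*δ : ∀ {n} (π : Permutation′ n) i (f : Fin n → ℚ) → sum (λ j → f j ℚ.* δ π i j) ≡ f (π ⟨$⟩ʳ i)
sum-*δ π i f = trans
  (sum-single _ (π ⟨$⟩ʳ i) λ j j≢ → trans (cong (f j ℚ.*_) (δ-off π i (j≢ ∘ sym))) (ℚ.*-zeroʳ (f j)))
  (trans (cong (f _ ℚ.*_) (δ-on π i refl)) (ℚ.*-identityʳ _))

δ-lineSums : ∀ {n} (π : Permutation′ n) → LineSums (δ π) 1ℚ
δ-lineSums π =
  (λ i → trans (sum-single _ (π ⟨$⟩ʳ i) (λ j j≢ → δ-off π i (j≢ ∘ sym))) (δ-on π i refl)) ,
  (λ j → trans
    (sum-single _ (π ⟨$⟩ˡ j) (λ i i≢ → δ-off π i λ e →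
      i≢ (trans (sym (Permutation.inverseˡ π)) (cong (π ⟨$⟩ˡ_) e))))
    (δ-on π (π ⟨$⟩ˡ j) (Permutation.inverseʳ π)))

subtract : ∀ {n} → Matrixℚ n → ℚ → Permutation′ n → Matrixℚ n
subtract R a π i j = R i j ℚ.- a ℚ.* δ π i j

subtract-on : ∀ {n} (R : Matrixℚ n) a π i → subtract R a π i (π ⟨$⟩ʳ i) ≡ R i (π ⟨$⟩ʳ i) ℚ.- a
subtract-on R a π i = cong (λ x → R i (π ⟨$⟩ʳ i) ℚ.- x) (trans (cong (a ℚ.*_) (δ-on π i refl)) (ℚ.*-identityʳ a))

subtract-nonNeg : ∀ {n} {R : Matrixℚ n} {a} π → NonNegative R → (∀ i → a ℚ.≤ R i (π ⟨$⟩ʳ i)) →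
                  NonNegative (subtract R a π)
subtract-nonNeg {R = R} {a} π 0≤R a≤ i j with π ⟨$⟩ʳ i Fin.≟ j
... | yes refl = gap (ℚ.≤-trans (ℚ.≤-reflexive (ℚ.*-identityʳ a)) (a≤ i))
... | no  _    = ℚ.≤-trans (0≤R i j)
  (ℚ.≤-reflexive (solve 2 (λ r a → r := r :- a :* con 0ℚ) refl (R i j) a))

subtract-≤ : ∀ {n} (R : Matrixℚ n) {a} π → 0ℚ ℚ.≤ a → ∀ i j → subtract R a π i j ℚ.≤ R i j
subtract-≤ R {a} π 0≤a i j = ≤-from-gap _ (0≤* 0≤a (δ-nonNeg π i j))
  (solve 2 (λ r x → r :- x :+ x := r) refl (R i j) (a ℚ.* δ π i j))

sum-subtract : ∀ {n} (f : Fin n → ℚ) a (d : Fin n → ℚ) {s} → sum f ≡ s → sum d ≡ 1ℚ →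
               sum (λ i → f i ℚ.- a ℚ.* d i) ≡ s ℚ.- a
sum-subtract f a d {s} e e′ = begin
  sum (λ i → f i ℚ.- a ℚ.* d i)       ≡⟨ sum-sub f (λ i → a ℚ.* d i) ⟩
  sum f ℚ.- sum (λ i → a ℚ.* d i)     ≡⟨ cong₂ ℚ._-_ e (sym (*-distribˡ-sum a d)) ⟩
  s ℚ.- a ℚ.* sum d                   ≡⟨ cong (λ x → s ℚ.- a ℚ.* x) e′ ⟩
  s ℚ.- a ℚ.* 1ℚ                      ≡⟨ cong (λ x → s ℚ.- x) (ℚ.*-identityʳ a) ⟩
  s ℚ.- a                             ∎
  where open ≡-Reasoning

subtract-lineSums : ∀ {n} (R : Matrixℚ n) {s} a π → LineSums R s → LineSums (subtract R a π) (s ℚ.- a)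
subtract-lineSums R a π (rows , columns) =
  (λ i → sum-subtract (R i) a (δ π i) (rows i) (proj₁ (δ-lineSums π) i)) ,
  (λ j → sum-subtract (λ i → R i j) a (λ i → δ π i j) (columns j) (proj₂ (δ-lineSums π) j))

-- Counting positive entries

isPositive : ℚ → ℕ
isPositive p = if does (0ℚ ℚ.<? p) then 1 else 0

isPositive-yes : ∀ {p} → 0ℚ ℚ.< p → isPositive p ≡ 1
isPositive-yes {p} 0<p rewrite dec-true (0ℚ ℚ.<? p) 0<p = refl

isPositive-no : ∀ {p} → p ℚ.≤ 0ℚ → isPositive p ≡ 0
isPositive-no {p} p≤0 rewrite dec-false (0ℚ ℚ.<? p) (λ 0<p → ℚ.<-irrefl refl (ℚ.<-≤-trans 0<p p≤0)) = refl

isPositive≤1 : ∀ p → isPositive p ℕ.≤ 1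
isPositive≤1 p with does (0ℚ ℚ.<? p)
... | true  = ℕ.≤-refl
... | false = ℕ.z≤n

isPositive-mono : ∀ {p q} → p ℚ.≤ q → isPositive p ℕ.≤ isPositive q
isPositive-mono {p} {q} p≤q = compare (0ℚ ℚ.<? p)
  where
  compare : Dec (0ℚ ℚ.< p) → isPositive p ℕ.≤ isPositive q
  compare (yes 0<p) = ℕ.≤-trans (isPositive≤1 p)
    (ℕ.≤-reflexive (sym (isPositive-yes (ℚ.<-≤-trans 0<p p≤q))))
  compare (no 0≮p)  = subst (ℕ._≤ isPositive q) (sym (isPositive-no (ℚ.≮⇒≥ 0≮p))) ℕ.z≤n

support : ∀ {n} → Matrixℚ n → ℕ
support R = ℕΣ.sum λ i → ℕΣ.sum λ j → isPositive (R i j)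

support-mono : ∀ {n} {R R′ : Matrixℚ n} → (∀ i j → R i j ℚ.≤ R′ i j) → support R ℕ.≤ support R′
support-mono h = ℕsum-mono λ i → ℕsum-mono λ j → isPositive-mono (h i j)

support-mono-< : ∀ {n} {R R′ : Matrixℚ n} → (∀ i j → R i j ℚ.≤ R′ i j) →
                 ∀ i j → R i j ℚ.≤ 0ℚ → 0ℚ ℚ.< R′ i j → support R ℕ.< support R′
support-mono-< h i j R≤0 0<R′ = ℕsum-mono-< (λ i → ℕsum-mono λ j → isPositive-mono (h i j)) i
  (ℕsum-mono-< (λ j → isPositive-mono (h i j)) j
    (subst₂ ℕ._<_ (sym (isPositive-no R≤0)) (sym (isPositive-yes 0<R′)) ℕ.≤-refl))

-- The entry `R i (π ⟨$⟩ʳ i)` falls from `a` to exactly zero, and no entry grows.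
support-subtract : ∀ {n} (R : Matrixℚ n) a π → 0ℚ ℚ.< a → ∀ i → a ≡ R i (π ⟨$⟩ʳ i) →
                   support (subtract R a π) ℕ.< support R
support-subtract R a π 0<a i refl = support-mono-< (subtract-≤ R π (ℚ.<⇒≤ 0<a)) i (π ⟨$⟩ʳ i)
  (ℚ.≤-reflexive (trans (subtract-on R a π i) (ℚ.+-inverseʳ a))) 0<a

-- Permutations with positive entries

-- A predicate of `n`, so that `cheapPermutation` can take it as induction hypothesis.
HasPositivePermutation : ℕ → Set
HasPositivePermutation n = ∀ (R : Matrixℚ n) {s} → NonNegative R → LineSums R s → 0ℚ ℚ.< s →
  ∃ λ (π : Permutation′ n) → ∀ i → 0ℚ ℚ.< R i (π ⟨$⟩ʳ i)

inner : ∀ {n} → Matrixℚ n → Matrixℚ n → ℚ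
inner C R = sum λ i → sum λ j → C i j ℚ.* R i j

-- The value of the linear functional `inner C` at `δ π`, in closed form.
cost : ∀ {n} → Matrixℚ n → Permutation′ n → ℚ
cost C π = sum λ i → C i (π ⟨$⟩ʳ i)

inner-subtract : ∀ {n} (C R : Matrixℚ n) a π → inner C (subtract R a π) ≡ inner C R ℚ.- a ℚ.* cost C π
inner-subtract C R a π = begin
  inner C (subtract R a π)
    ≡⟨ sum-cong-≗ row ⟩
  sum (λ i → sum (λ j → C i j ℚ.* R i j) ℚ.- a ℚ.* C i (π ⟨$⟩ʳ i))
    ≡⟨ sum-sub (λ i → sum (λ j → C i j ℚ.* R i j)) (λ i → a ℚ.* C i (π ⟨$⟩ʳ i)) ⟩
  inner C R ℚ.- sum (λ i → a ℚ.* C i (π ⟨$⟩ʳ i))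
    ≡⟨ cong (λ x → inner C R ℚ.- x) (sym (*-distribˡ-sum a (λ i → C i (π ⟨$⟩ʳ i)))) ⟩
  inner C R ℚ.- a ℚ.* cost C π ∎
  where
  open ≡-Reasoning
  row : ∀ i → sum (λ j → C i j ℚ.* subtract R a π i j) ≡
              sum (λ j → C i j ℚ.* R i j) ℚ.- a ℚ.* C i (π ⟨$⟩ʳ i)
  row i = begin
    sum (λ j → C i j ℚ.* (R i j ℚ.- a ℚ.* δ π i j))
      ≡⟨ sum-cong-≗ (λ j → solve 4 (λ c r a d → c :* (r :- a :* d) := c :* r :- a :* (c :* d)) refl
           (C i j) (R i j) a (δ π i j)) ⟩
    sum (λ j → C i j ℚ.* R i j ℚ.- a ℚ.* (C i j ℚ.* δ π i j))
      ≡⟨ sum-sub (λ j → C i j ℚ.* R i j) (λ j → a ℚ.* (C i j ℚ.* δ π i j)) ⟩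
    sum (λ j → C i j ℚ.* R i j) ℚ.- sum (λ j → a ℚ.* (C i j ℚ.* δ π i j))
      ≡⟨ cong (λ x → sum (λ j → C i j ℚ.* R i j) ℚ.- x) (trans
           (sym (*-distribˡ-sum a (λ j → C i j ℚ.* δ π i j)))
           (cong (a ℚ.*_) (sum-*δ π i (C i)))) ⟩
    sum (λ j → C i j ℚ.* R i j) ℚ.- a ℚ.* C i (π ⟨$⟩ʳ i) ∎

-- If every permutation peeled off R had cost at least 1, inner C R would be at least s.
cheapPermutation : ∀ {n} → HasPositivePermutation n → ∀ (C : Matrixℚ n) → NonNegative C →
  ∀ m (R : Matrixℚ n) {s} → support R ℕ.≤ m → NonNegative R → LineSums R s → inner C R ℚ.< s →
  ∃ λ π → cost C π ℚ.< 1ℚ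
-- An empty sum costs 0; from size 1 on, `argmin` has an index to return.
cheapPermutation {zero} _ C 0≤C m R _ _ _ _ = Permutation.id , 0<1
cheapPermutation {suc n} pos C 0≤C m R {s} #R≤m 0≤R lines CR<s
  with pos R 0≤R lines
         (ℚ.≤-<-trans (sum-nonNeg λ i → sum-nonNeg λ j → 0≤* (0≤C i j) (0≤R i j)) CR<s)
... | π , 0<Rπ with cost C π ℚ.<? 1ℚ
...   | yes c<1 = π , c<1
...   | no  c≮1 with argmin (λ i → R i (π ⟨$⟩ʳ i))
...     | k , min = next m #R≤m
  where
  a : ℚ
  a = R k (π ⟨$⟩ʳ k)
  smaller : support (subtract R a π) ℕ.< support R
  smaller = support-subtract R a π (0<Rπ k) k refl
  -- As `π` costs at least 1, `inner C R` drops by at least `a` while the line sum drops by exactly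
  -- `a`: the strict inequality survives.
  CR′< : inner C (subtract R a π) ℚ.< s ℚ.- a
  CR′< = begin-strict
    inner C (subtract R a π)         ≡⟨ inner-subtract C R a π ⟩
    inner C R ℚ.- a ℚ.* cost C π     <⟨ ℚ.+-monoˡ-< (ℚ.- (a ℚ.* cost C π)) CR<s ⟩
    s ℚ.- a ℚ.* cost C π             ≤⟨ ≤-from-gap _ (0≤* (0≤R k _) (gap (ℚ.≮⇒≥ c≮1)))
                                        (solve 3 (λ s a c → s :- a :* c :+ a :* (c :- con 1ℚ) := s :- a) refl
                                          s a (cost C π)) ⟩
    s ℚ.- a                          ∎
    where open ℚ.≤-Reasoning
  -- The recursion is on the bound `m`, which can be lowered because removing `a` shrinks the
  -- support.
  next : ∀ m → support R ℕ.≤ m → ∃ λ π → cost C π ℚ.< 1ℚ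
  next zero    #R≤0 = ⊥-elim (ℕ.n≮0 (ℕ.<-≤-trans smaller #R≤0))
  next (suc m) #R≤  = cheapPermutation pos C 0≤C m (subtract R a π)
    (ℕ.s≤s⁻¹ (ℕ.≤-trans smaller #R≤)) (subtract-nonNeg π 0≤R min)
    (subtract-lineSums R a π lines) CR′<

-- Contracting a row and a column

isNonPositive : ℚ → ℚ
isNonPositive p = if does (0ℚ ℚ.<? p) then 0ℚ else 1ℚ

isNonPositive-no : ∀ {p} → 0ℚ ℚ.< p → isNonPositive p ≡ 0ℚ
isNonPositive-no {p} 0<p rewrite dec-true (0ℚ ℚ.<? p) 0<p = refl

isNonPositive-yes : ∀ {p} → p ℚ.≤ 0ℚ → isNonPositive p ≡ 1ℚ
isNonPositive-yes {p} p≤0 rewrite dec-false (0ℚ ℚ.<? p) (λ 0<p → ℚ.<-irrefl refl (ℚ.<-≤-trans 0<p p≤0)) = refl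

isNonPositive-nonNeg : ∀ p → 0ℚ ℚ.≤ isNonPositive p
isNonPositive-nonNeg p with does (0ℚ ℚ.<? p)
... | true  = ℚ.≤-refl
... | false = 0≤1

isNonPositive<1 : ∀ {p} → isNonPositive p ℚ.< 1ℚ → 0ℚ ℚ.< p
isNonPositive<1 {p} <1 = ℚ.≰⇒> λ p≤0 → ℚ.<-irrefl (isNonPositive-yes p≤0) <1

-- For `p` from the minor and `v` the rerouted mass: an entry that is positive without rerouting is
-- free, and any other is charged at most `v`.
isNonPositive-*-+ : ∀ p {v} → 0ℚ ℚ.≤ v → isNonPositive p ℚ.* (p ℚ.+ v) ℚ.≤ v
isNonPositive-*-+ p {v} 0≤v = bound (0ℚ ℚ.<? p)
  where
  open ℚ.≤-Reasoning
  bound : Dec (0ℚ ℚ.< p) → isNonPositive p ℚ.* (p ℚ.+ v) ℚ.≤ v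
  bound (yes 0<p) = begin
    isNonPositive p ℚ.* (p ℚ.+ v)  ≡⟨ cong (ℚ._* (p ℚ.+ v)) (isNonPositive-no 0<p) ⟩
    0ℚ ℚ.* (p ℚ.+ v)               ≡⟨ ℚ.*-zeroˡ (p ℚ.+ v) ⟩
    0ℚ                             ≤⟨ 0≤v ⟩
    v                              ∎
  bound (no 0≮p) = begin
    isNonPositive p ℚ.* (p ℚ.+ v)  ≡⟨ cong (ℚ._* (p ℚ.+ v)) (isNonPositive-yes (ℚ.≮⇒≥ 0≮p)) ⟩
    1ℚ ℚ.* (p ℚ.+ v)               ≡⟨ ℚ.*-identityˡ (p ℚ.+ v) ⟩
    p ℚ.+ v                        ≤⟨ ℚ.+-monoˡ-≤ v (ℚ.≮⇒≥ 0≮p) ⟩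
    0ℚ ℚ.+ v                       ≡⟨ ℚ.+-identityˡ v ⟩
    v                              ∎

-- The inverse of d, or 0 if d = 0; then 0 ≤ x ≤ d leaves only x = 0.
inverseBelow : ∀ {d} → 0ℚ ℚ.≤ d →
  ∃ λ w → 0ℚ ℚ.≤ w × (∀ {x} → 0ℚ ℚ.≤ x → x ℚ.≤ d → x ℚ.* (d ℚ.* w) ≡ x)
inverseBelow {d} 0≤d with 0ℚ ℚ.<? d
... | yes 0<d = (ℚ.1/ d) {{nz}} , ℚ.<⇒≤ (ℚ.positive⁻¹ _ {{ℚ.1/pos⇒pos d {{pos}}}}) ,
  λ {x} _ _ → trans (cong (x ℚ.*_) (ℚ.*-inverseʳ d {{nz}})) (ℚ.*-identityʳ x)
  where
  pos = ℚ.positive 0<d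
  nz  = ℚ.pos⇒nonZero d {{pos}}
... | no  0≮d = 0ℚ , ℚ.≤-refl , λ {x} 0≤x x≤d →
  subst (λ x → x ℚ.* (d ℚ.* 0ℚ) ≡ x) (ℚ.≤-antisym 0≤x (ℚ.≤-trans x≤d (ℚ.≮⇒≥ 0≮d)))
    (ℚ.*-zeroˡ (d ℚ.* 0ℚ))

sum-punchIn : ∀ {n} (f : Fin (suc n) → ℚ) k {s} → sum f ≡ s → sum (f ∘ punchIn k) ≡ s ℚ.- f k
sum-punchIn f k refl = sym (trans (cong (ℚ._- f k) (sum-remove {i = k} f))
  (solve 2 (λ x y → x :+ y :- x := y) refl (f k) (sum (f ∘ punchIn k))))

module _ {n} (R : Matrixℚ (suc n)) {s} (0≤R : NonNegative R) (lines : LineSums R s)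
         (j : Fin (suc n)) (0<R₀ⱼ : 0ℚ ℚ.< R zero j) where

  private
    d : ℚ
    d = s ℚ.- R zero j

    row₀ : sum (R zero ∘ punchIn j) ≡ d
    row₀ = sum-punchIn (R zero) j (proj₁ lines zero)

    columnⱼ : sum (λ i → R (suc i) j) ≡ d
    columnⱼ = sum-punchIn (λ i → R i j) zero (proj₂ lines j)

    R₀≤d : ∀ k → R zero (punchIn j k) ℚ.≤ d
    R₀≤d k = ℚ.≤-trans (term≤sum (λ k → 0≤R zero (punchIn j k)) k) (ℚ.≤-reflexive row₀)

    Rⱼ≤d : ∀ i → R (suc i) j ℚ.≤ d
    Rⱼ≤d i = ℚ.≤-trans (term≤sum (λ i → 0≤R (suc i) j) i) (ℚ.≤-reflexive columnⱼ)

    0≤d : 0ℚ ℚ.≤ d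
    0≤d = subst (0ℚ ℚ.≤_) row₀ (sum-nonNeg λ k → 0≤R zero (punchIn j k))

    d<s : d ℚ.< s
    d<s = <-from-gap _ 0<R₀ⱼ (solve 2 (λ s c → s :- c :+ c := s) refl s (R zero j))

    w : ℚ
    w = proj₁ (inverseBelow 0≤d)

    0≤w : 0ℚ ℚ.≤ w
    0≤w = proj₁ (proj₂ (inverseBelow 0≤d))

    w-inverse : ∀ {x} → 0ℚ ℚ.≤ x → x ℚ.≤ d → x ℚ.* (d ℚ.* w) ≡ x
    w-inverse = proj₂ (proj₂ (inverseBelow 0≤d))

    -- detour redistributes the mass R (suc i) j in proportion to the rest of row 0,
    -- which restores the line sums lost in the minor.
    minor detour : Matrixℚ n
    minor i k = R (suc i) (punchIn j k)
    detour i k = R (suc i) j ℚ.* (R zero (punchIn j k) ℚ.* w)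

    detour-nonNeg : NonNegative detour
    detour-nonNeg i k = 0≤* (0≤R (suc i) j) (0≤* (0≤R zero (punchIn j k)) 0≤w)

    detour-row : ∀ i → sum (detour i) ≡ R (suc i) j
    detour-row i = begin
      sum (detour i)
        ≡⟨ sym (*-distribˡ-sum (R (suc i) j) (λ k → R zero (punchIn j k) ℚ.* w)) ⟩
      R (suc i) j ℚ.* sum (λ k → R zero (punchIn j k) ℚ.* w)
        ≡⟨ cong (R (suc i) j ℚ.*_) (sym (*-distribʳ-sum w (R zero ∘ punchIn j))) ⟩
      R (suc i) j ℚ.* (sum (R zero ∘ punchIn j) ℚ.* w)
        ≡⟨ cong (λ x → R (suc i) j ℚ.* (x ℚ.* w)) row₀ ⟩
      R (suc i) j ℚ.* (d ℚ.* w)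
        ≡⟨ w-inverse (0≤R (suc i) j) (Rⱼ≤d i) ⟩
      R (suc i) j ∎
      where open ≡-Reasoning

    detour-column : ∀ k → sum (λ i → detour i k) ≡ R zero (punchIn j k)
    detour-column k = begin
      sum (λ i → detour i k)
        ≡⟨ sym (*-distribʳ-sum (R zero (punchIn j k) ℚ.* w) (λ i → R (suc i) j)) ⟩
      sum (λ i → R (suc i) j) ℚ.* (R zero (punchIn j k) ℚ.* w)
        ≡⟨ cong (ℚ._* (R zero (punchIn j k) ℚ.* w)) columnⱼ ⟩
      d ℚ.* (R zero (punchIn j k) ℚ.* w)
        ≡⟨ solve 3 (λ d r w → d :* (r :* w) := r :* (d :* w)) refl d (R zero (punchIn j k)) w ⟩
      R zero (punchIn j k) ℚ.* (d ℚ.* w)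
        ≡⟨ w-inverse (0≤R zero (punchIn j k)) (R₀≤d k) ⟩
      R zero (punchIn j k) ∎
      where open ≡-Reasoning

  contraction : Matrixℚ n
  contraction i k = minor i k ℚ.+ detour i k

  contraction-nonNeg : NonNegative contraction
  contraction-nonNeg i k = 0≤+ (0≤R (suc i) (punchIn j k)) (detour-nonNeg i k)

  contraction-lineSums : LineSums contraction s
  contraction-lineSums =
    (λ i → trans (∑-distrib-+ (minor i) (detour i)) (trans
      (cong₂ ℚ._+_ (sum-punchIn (R (suc i)) j (proj₁ lines (suc i))) (detour-row i))
      (cancel (R (suc i) j)))) ,
    (λ k → trans (∑-distrib-+ (λ i → minor i k) (λ i → detour i k)) (trans
      (cong₂ ℚ._+_ (sum-punchIn (λ i → R i (punchIn j k)) zero (proj₂ lines (punchIn j k))) (detour-column k))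
      (cancel (R zero (punchIn j k)))))
    where
    cancel : ∀ x → s ℚ.- x ℚ.+ x ≡ s
    cancel x = solve 2 (λ s x → s :- x :+ x := s) refl s x

  contraction-cost : Matrixℚ n
  contraction-cost i k = isNonPositive (minor i k)

  -- Only rerouted mass is charged. It totals `d`, which is below `s` because the entry `R zero j`
  -- is positive.
  inner-contraction : inner contraction-cost contraction ℚ.< s
  inner-contraction = begin-strict
    inner contraction-cost contraction
      ≤⟨ sum-mono (λ i → sum-mono λ k → isNonPositive-*-+ (minor i k) (detour-nonNeg i k)) ⟩
    sum (λ i → sum (detour i))   ≡⟨ sum-cong-≗ detour-row ⟩
    sum (λ i → R (suc i) j)      ≡⟨ columnⱼ ⟩
    d                            <⟨ d<s ⟩
    s                            ∎
    where open ℚ.≤-Reasoning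


  -- Each single cost is 0 or 1, so a total below 1 makes all of them 0: `π` uses only positive
  -- entries of the minor. Inserting `zero ↦ j` adds the positive entry `R zero j`.
  positive-from-contraction : (∃ λ π → cost contraction-cost π ℚ.< 1ℚ) → ∃ λ π → ∀ i → 0ℚ ℚ.< R i (π ⟨$⟩ʳ i)
  positive-from-contraction (π , cheap) = Permutation.insert zero j π , positive
    where
    positive : ∀ i → 0ℚ ℚ.< R i (Permutation.insert zero j π ⟨$⟩ʳ i)
    positive zero    = 0<R₀ⱼ
    positive (suc i) = subst (λ k → 0ℚ ℚ.< R (suc i) k)
      (sym (Permutation.insert-punchIn zero j π i))
      (isNonPositive<1 (ℚ.≤-<-trans
        (term≤sum {f = λ i → contraction-cost i (π ⟨$⟩ʳ i)}
          (λ i → isNonPositive-nonNeg (minor i (π ⟨$⟩ʳ i))) i)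
        cheap))

positivePermutation : ∀ n → HasPositivePermutation n
positivePermutation zero    R _ _ _ = Permutation.id , λ ()
positivePermutation (suc n) R {s} 0≤R lines 0<s =
  contract (sum-positive (R zero) (subst (0ℚ ℚ.<_) (sym (proj₁ lines zero)) 0<s))
  where
  contract : (∃ λ j → 0ℚ ℚ.< R zero j) → ∃ λ π → ∀ i → 0ℚ ℚ.< R i (π ⟨$⟩ʳ i)
  contract (j , 0<R₀ⱼ) = positive-from-contraction R 0≤R lines j 0<R₀ⱼ
    (cheapPermutation (positivePermutation n)
      (contraction-cost R 0≤R lines j 0<R₀ⱼ) (λ i k → isNonPositive-nonNeg (R (suc i) (punchIn j k)))
      (support (contraction R 0≤R lines j 0<R₀ⱼ)) (contraction R 0≤R lines j 0<R₀ⱼ) ℕ.≤-refl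
      (contraction-nonNeg R 0≤R lines j 0<R₀ⱼ) (contraction-lineSums R 0≤R lines j 0<R₀ⱼ)
      (inner-contraction R 0≤R lines j 0<R₀ⱼ))

-- The greedy recursion at a fixed term of the sequences

seq-∑ : ∀ {n} (f : Fin n → ℝ) t → seq (∑ f) t ≡ sum (λ i → seq (f i) t)
seq-∑ {zero}  f t = refl
seq-∑ {suc n} f t = cong (seq (f zero) t ℚ.+_) (seq-∑ (f ∘ suc) t)

seq-permutationMatrix : ∀ {n} (π : Permutation′ n) i j t → seq (permutationMatrix π i j) t ≡ δ π i j
seq-permutationMatrix π i j t with does (π ⟨$⟩ʳ i Fin.≟ j)
... | true  = refl
... | false = refl

-- `minimum` folds the tail with the head as seed, so the head sits innermost and gets its own
-- induction.
minimum-≤ : ∀ {x xs} → x ∈ˡ xs → ∀ t → seq (minimum xs) t ℚ.≤ seq x t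
minimum-≤ {xs = y ∷ ys} (here refl) t = head≤ ys
  where
  head≤ : ∀ ys → seq (List.foldr _⊓_ y ys) t ℚ.≤ seq y t
  head≤ []       = ℚ.≤-refl
  head≤ (z ∷ zs) = ℚ.≤-trans (ℚ.p⊓q≤q (seq z t) _) (head≤ zs)
minimum-≤ {x} {y ∷ ys} (there x∈ys) t = tail≤ x∈ys
  where
  tail≤ : ∀ {zs} → x ∈ˡ zs → seq (List.foldr _⊓_ y zs) t ℚ.≤ seq x t
  tail≤ (here refl)          = ℚ.p⊓q≤p (seq x t) _
  tail≤ {z ∷ zs} (there x∈) = ℚ.≤-trans (ℚ.p⊓q≤q (seq z t) _) (tail≤ x∈)

-- The membership hypothesis excludes the empty list and its default value. The minimising element
-- may change with `t`.
minimum-attained : ∀ {x xs} → x ∈ˡ xs → ∀ t → ∃ λ y → y ∈ˡ xs × seq (minimum xs) t ≡ seq y t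
minimum-attained {xs = x ∷ xs} _ t = attained xs
  where
  attained : ∀ ys → ∃ λ y → y ∈ˡ x ∷ ys × seq (List.foldr _⊓_ x ys) t ≡ seq y t
  attained [] = x , here refl , refl
  attained (y ∷ ys) with ℚ.⊓-sel (seq y t) (seq (List.foldr _⊓_ x ys) t)
  ... | inj₁ e = y , there (here refl) , e
  ... | inj₂ e with attained ys
  ...   | z , here refl , e′ = z , here refl , trans e e′
  ...   | z , there z∈ , e′  = z , there (there z∈) , trans e e′

∈-ones : ∀ {n} (π : Permutation′ n) i → (i , π ⟨$⟩ʳ i) ∈ˡ ones π
∈-ones π i = ∈-filter⁺ _ (∈-cartesianProduct⁺ (∈-allFin i) (∈-allFin (π ⟨$⟩ʳ i))) refl

ones⁻ : ∀ {n} (π : Permutation′ n) {i j} → (i , j) ∈ˡ ones π → π ⟨$⟩ʳ i ≡ j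
ones⁻ {n} π ∈ones = proj₂ (∈-filter⁻ (λ (i , j) → π ⟨$⟩ʳ i Fin.≟ j)
  {xs = cartesianProduct (allFin n) (allFin n)} ∈ones)

-- The induction splits off the first step, as `sum` does, and shifts `h` and `T`. Irrelevance of
-- the bounds makes the shifted instances agree.
telescope : ∀ N (h : ∀ k → .(k ℕ.< N) → ℚ) (T : ∀ k → .(k ℕ.≤ N) → ℚ) →
  (∀ k .(k<N : k ℕ.< N) → T (suc k) k<N ≡ T k (ℕ.<⇒≤ k<N) ℚ.+ h k k<N) →
  T N ℕ.≤-refl ≡ T 0 ℕ.z≤n ℚ.+ sum (λ ℓ → h (Fin.toℕ ℓ) (Fin.toℕ<n ℓ))
telescope zero    h T step = sym (ℚ.+-identityʳ (T 0 _))
telescope (suc N) h T step = trans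
  (telescope N (λ k k<N → h (suc k) (ℕ.s≤s k<N)) (λ k k≤N → T (suc k) (ℕ.s≤s k≤N))
    (λ k k<N → step (suc k) (ℕ.s≤s k<N)))
  (trans (cong (ℚ._+ _) (step 0 (ℕ.s≤s ℕ.z≤n))) (ℚ.+-assoc (T 0 _) (h 0 _) _))

module _ {n N} (P : Fin N → Permutation′ n) (A : Matrix n) (t : ℕ) where

  coef : ∀ k → .(k ℕ.< N) → ℚ
  coef k k<N = seq (coefficientAt P A k k<N) t

  partial : ∀ k → .(k ℕ.≤ N) → Matrixℚ n
  partial k k≤N i j = seq (partialSum P A k k≤N i j) t

  residual : ∀ k → .(k ℕ.≤ N) → Matrixℚ n
  residual k k≤N i j = seq (A i j) t ℚ.- partial k k≤N i j

  module _ k .(k<N : k ℕ.< N) where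

    private π = P (Fin.fromℕ< k<N)

    partial-suc : ∀ i j → partial (suc k) k<N i j ≡ partial k (ℕ.<⇒≤ k<N) i j ℚ.+ coef k k<N ℚ.* δ π i j
    partial-suc i j = cong (λ x → partial k (ℕ.<⇒≤ k<N) i j ℚ.+ coef k k<N ℚ.* x)
      (seq-permutationMatrix π i j t)

    -- The recursion accumulates partial sums; here it becomes successive subtraction from the
    -- residual.
    residual-suc : ∀ i j → residual (suc k) k<N i j ≡ subtract (residual k (ℕ.<⇒≤ k<N)) (coef k k<N) π i j
    residual-suc i j = trans (cong (λ x → seq (A i j) t ℚ.- x) (partial-suc i j))
      (solve 3 (λ a p x → a :- (p :+ x) := a :- p :- x) refl
        (seq (A i j) t) (partial k (ℕ.<⇒≤ k<N) i j) (coef k k<N ℚ.* δ π i j))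

    coef-≤ : ∀ i → coef k k<N ℚ.≤ residual k (ℕ.<⇒≤ k<N) i (π ⟨$⟩ʳ i)
    coef-≤ i = minimum-≤ (∈-map⁺ _ (∈-ones π i)) t

    -- The index shows that `ones π` is nonempty; for `n = 0` the coefficient would be the default
    -- value of `minimum`.
    coef-attained : Fin n → ∃ λ i → coef k k<N ≡ residual k (ℕ.<⇒≤ k<N) i (π ⟨$⟩ʳ i)
    coef-attained i with minimum-attained (∈-map⁺
        (λ (i , j) → A i j - partialSum P A k (ℕ.<⇒≤ k<N) i j) (∈-ones π i)) t
    ... | _ , y∈ , e with ∈-map⁻ _ y∈
    ...   | (i , j) , ij∈ , refl with ones⁻ π ij∈
    ...     | refl = i , e

-- The counter `z` never rises, and falls at each element of `S` from a value of at least `c`. Every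
-- fall but the last therefore ends at `c` or above, and the `suc` accounts for the last one.
subset-countdown : ∀ {N} (S : Subset N) (z : ∀ k → .(k ℕ.≤ N) → ℕ) c →
  (∀ k .(k<N : k ℕ.< N) → z (suc k) k<N ℕ.≤ z k (ℕ.<⇒≤ k<N)) →
  (∀ ℓ → ℓ ∈ S → z (suc (Fin.toℕ ℓ)) (Fin.toℕ<n ℓ) ℕ.< z (Fin.toℕ ℓ) (ℕ.<⇒≤ (Fin.toℕ<n ℓ))) →
  (∀ ℓ → ℓ ∈ S → c ℕ.≤ z (Fin.toℕ ℓ) (ℕ.<⇒≤ (Fin.toℕ<n ℓ))) →
  ∣ S ∣ ℕ.≤ suc (z 0 ℕ.z≤n) ∸ c
subset-countdown [] z c mono strict cap = ℕ.z≤n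
subset-countdown {suc N} (b ∷ S) z c mono strict cap = prepend b
    (λ { refl → strict zero here , cap zero here })
  where
  rest : ∣ S ∣ ℕ.≤ suc (z 1 (ℕ.s≤s ℕ.z≤n)) ∸ c
  rest = subset-countdown S (λ k k≤N → z (suc k) (ℕ.s≤s k≤N)) c
    (λ k k<N → mono (suc k) (ℕ.s≤s k<N))
    (λ ℓ ℓ∈S → strict (suc ℓ) (there ℓ∈S)) (λ ℓ ℓ∈S → cap (suc ℓ) (there ℓ∈S))
  prepend : ∀ b → (b ≡ inside → z 1 (ℕ.s≤s ℕ.z≤n) ℕ.< z 0 ℕ.z≤n × c ℕ.≤ z 0 ℕ.z≤n) →
           ∣ b ∷ S ∣ ℕ.≤ suc (z 0 ℕ.z≤n) ∸ c
  prepend false _ = ℕ.≤-trans rest (ℕ.∸-monoˡ-≤ c (ℕ.s≤s (mono 0 (ℕ.s≤s ℕ.z≤n))))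
  -- From `c ≤ z 0` the truncated difference releases the `suc` that pays for this element.
  prepend true  h = subst (suc ∣ S ∣ ℕ.≤_) (sym (ℕ.+-∸-assoc 1 (proj₂ (h refl))))
    (ℕ.s≤s (ℕ.≤-trans rest (ℕ.∸-monoˡ-≤ c (proj₁ (h refl)))))

ℕsum-const : ∀ n c → ℕΣ.sum {n} (λ _ → c) ≡ n ℕ.* c
ℕsum-const zero    c = refl
ℕsum-const (suc n) c = cong (c ℕ.+_) (ℕsum-const n c)

ℕterm≤sum : ∀ {n} (f : Fin n → ℕ) i → f i ℕ.≤ ℕΣ.sum f
ℕterm≤sum f zero    = ℕ.m≤m+n _ _
ℕterm≤sum f (suc i) = ℕ.≤-trans (ℕterm≤sum (f ∘ suc) i) (ℕ.m≤n+m _ (f zero))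

support≤n*n : ∀ {n} (R : Matrixℚ n) → support R ℕ.≤ n ℕ.* n
support≤n*n {n} R = ℕ.≤-trans
  (ℕsum-mono λ i → ℕ.≤-trans (ℕsum-mono λ j → isPositive≤1 (R i j))
    (ℕ.≤-reflexive (trans (ℕsum-const n 1) (ℕ.*-identityʳ n))))
  (ℕ.≤-reflexive (ℕsum-const n n))

n≤support : ∀ {n} (R : Matrixℚ n) π → (∀ i → 0ℚ ℚ.< R i (π ⟨$⟩ʳ i)) → n ℕ.≤ support R
n≤support {n} R π 0<Rπ = ℕ.≤-trans
  (ℕ.≤-reflexive (sym (trans (ℕsum-const n 1) (ℕ.*-identityʳ n))))
  (ℕsum-mono λ i → ℕ.≤-trans (ℕ.≤-reflexive (sym (isPositive-yes (0<Rπ i))))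
    (ℕterm≤sum (λ j → isPositive (R i j)) (π ⟨$⟩ʳ i)))

LineSums-cong : ∀ {n} {R R′ : Matrixℚ n} {s} → (∀ i j → R i j ≡ R′ i j) → LineSums R s → LineSums R′ s
LineSums-cong R≡R′ (rows , columns) =
  (λ i → trans (sym (sum-cong-≗ (R≡R′ i))) (rows i)) ,
  (λ j → trans (sym (sum-cong-≗ (λ i → R≡R′ i j))) (columns j))

-- The recursion on exact rational matrices

module Exact {n N} (P : Fin N → Permutation′ n) (A : Matrix n) (t : ℕ) (i₀ : Fin n) {s}
             (0≤A : NonNegative (λ i j → seq (A i j) t)) (lines : LineSums (λ i j → seq (A i j) t) s) where

  private
    R : ∀ k → .(k ℕ.≤ N) → Matrixℚ n
    R = residual P A t

    a : ∀ k → .(k ℕ.< N) → ℚ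
    a = coef P A t

    R₀ : ∀ i j → seq (A i j) t ≡ R 0 ℕ.z≤n i j
    R₀ i j = solve 1 (λ x → x := x :- con 0ℚ) refl (seq (A i j) t)

  residual-nonNeg : ∀ k .(k≤N : k ℕ.≤ N) → NonNegative (R k k≤N)
  residual-nonNeg zero    _   i j = subst (0ℚ ℚ.≤_) (R₀ i j) (0≤A i j)
  residual-nonNeg (suc k) k<N i j = subst (0ℚ ℚ.≤_) (sym (residual-suc P A t k k<N i j))
    (subtract-nonNeg (P (Fin.fromℕ< k<N)) (residual-nonNeg k (ℕ.<⇒≤ k<N)) (coef-≤ P A t k k<N) i j)

  coef-nonNeg : ∀ k .(k<N : k ℕ.< N) → 0ℚ ℚ.≤ a k k<N
  coef-nonNeg k k<N with coef-attained P A t k k<N i₀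
  ... | i , e = subst (0ℚ ℚ.≤_) (sym e) (residual-nonNeg k (ℕ.<⇒≤ k<N) i _)

  residual-suc-≤ : ∀ k .(k<N : k ℕ.< N) i j → R (suc k) k<N i j ℚ.≤ R k (ℕ.<⇒≤ k<N) i j
  residual-suc-≤ k k<N i j = ℚ.≤-trans (ℚ.≤-reflexive (residual-suc P A t k k<N i j))
    (subtract-≤ (R k (ℕ.<⇒≤ k<N)) (P (Fin.fromℕ< k<N)) (coef-nonNeg k k<N) i j)

  -- Carries a zero created at one step to the final residual.
  residual-antitone : ∀ {k} m .(k≤N : k ℕ.≤ N) .(m≤N : m ℕ.≤ N) → k ℕ.≤ m → ∀ i j →
                      R m m≤N i j ℚ.≤ R k k≤N i j
  residual-antitone m k≤N m≤N k≤m i j with ℕ.m≤n⇒m<n∨m≡n k≤m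
  ... | inj₂ refl = ℚ.≤-refl
  residual-antitone (suc m) k≤N m<N _ i j | inj₁ (ℕ.s≤s k≤m) =
    ℚ.≤-trans (residual-suc-≤ m m<N i j) (residual-antitone m k≤N (ℕ.<⇒≤ m<N) k≤m i j)

  -- The line sum left after `k` steps. It starts at a general `s`, since repaired matrices have
  -- line sums only close to 1.
  remaining : ∀ k → .(k ℕ.≤ N) → ℚ
  remaining zero    _   = s
  remaining (suc k) k<N = remaining k (ℕ.<⇒≤ k<N) ℚ.- a k k<N

  residual-lineSums : ∀ k .(k≤N : k ℕ.≤ N) → LineSums (R k k≤N) (remaining k k≤N)
  residual-lineSums zero    _   = LineSums-cong R₀ lines
  residual-lineSums (suc k) k<N = LineSums-cong (λ i j → sym (residual-suc P A t k k<N i j))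
    (subtract-lineSums (R k (ℕ.<⇒≤ k<N)) (a k k<N) (P (Fin.fromℕ< k<N)) (residual-lineSums k (ℕ.<⇒≤ k<N)))

  -- Step `ℓ` subtracts the minimum from the entry that attains it, and later residuals are no
  -- larger.
  residual-vanishes : ∀ ℓ → ∃ λ i → R N ℕ.≤-refl i (P ℓ ⟨$⟩ʳ i) ℚ.≤ 0ℚ
  residual-vanishes ℓ = vanishes (coef-attained P A t (Fin.toℕ ℓ) (Fin.toℕ<n ℓ) i₀)
    where
    open ℚ.≤-Reasoning
    k = Fin.toℕ ℓ
    π = P (Fin.fromℕ< (Fin.toℕ<n ℓ))
    vanishes : (∃ λ i → a k (Fin.toℕ<n ℓ) ≡ R k (ℕ.<⇒≤ (Fin.toℕ<n ℓ)) i (π ⟨$⟩ʳ i)) →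
               ∃ λ i → R N ℕ.≤-refl i (P ℓ ⟨$⟩ʳ i) ℚ.≤ 0ℚ
    vanishes (i , e) = i , (begin
      R N ℕ.≤-refl i (P ℓ ⟨$⟩ʳ i)
        ≡⟨ cong (λ ℓ → R N ℕ.≤-refl i (P ℓ ⟨$⟩ʳ i)) (sym (Fin.fromℕ<-toℕ ℓ (Fin.toℕ<n ℓ))) ⟩
      R N ℕ.≤-refl i (π ⟨$⟩ʳ i)
        ≤⟨ residual-antitone N (Fin.toℕ<n ℓ) ℕ.≤-refl (Fin.toℕ<n ℓ) i (π ⟨$⟩ʳ i) ⟩
      R (suc k) (Fin.toℕ<n ℓ) i (π ⟨$⟩ʳ i)
        ≡⟨ residual-suc P A t k (Fin.toℕ<n ℓ) i (π ⟨$⟩ʳ i) ⟩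
      subtract (R k (ℕ.<⇒≤ (Fin.toℕ<n ℓ))) (a k (Fin.toℕ<n ℓ)) π i (π ⟨$⟩ʳ i)
        ≡⟨ subtract-on (R k (ℕ.<⇒≤ (Fin.toℕ<n ℓ))) (a k (Fin.toℕ<n ℓ)) π i ⟩
      R k (ℕ.<⇒≤ (Fin.toℕ<n ℓ)) i (π ⟨$⟩ʳ i) ℚ.- a k (Fin.toℕ<n ℓ)
        ≡⟨ cong (ℚ._- a k (Fin.toℕ<n ℓ)) (sym e) ⟩
      a k (Fin.toℕ<n ℓ) ℚ.- a k (Fin.toℕ<n ℓ)
        ≡⟨ ℚ.+-inverseʳ (a k (Fin.toℕ<n ℓ)) ⟩
      0ℚ ∎)

  module _ (covers : ∀ π → ∃ λ ℓ → ∀ i → P ℓ ⟨$⟩ʳ i ≡ π ⟨$⟩ʳ i) where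

    private
      r : ℚ
      r = remaining N ℕ.≤-refl

      row : sum (R N ℕ.≤-refl i₀) ≡ r
      row = proj₁ (residual-lineSums N ℕ.≤-refl) i₀

    remaining≤0 : r ℚ.≤ 0ℚ
    remaining≤0 = ℚ.≮⇒≥ λ 0<r →
      let π , 0<Rπ = positivePermutation n (R N ℕ.≤-refl) (residual-nonNeg N ℕ.≤-refl)
                       (residual-lineSums N ℕ.≤-refl) 0<r
          ℓ , Pℓ≡π = covers π
          i , R≤0  = residual-vanishes ℓ
      in ℚ.<-irrefl refl (ℚ.<-≤-trans (0<Rπ i) (subst (λ j → R N ℕ.≤-refl i j ℚ.≤ 0ℚ) (Pℓ≡π i) R≤0))

    remaining≡0 : r ≡ 0ℚ
    remaining≡0 = ℚ.≤-antisym remaining≤0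
      (subst (0ℚ ℚ.≤_) row (sum-nonNeg (residual-nonNeg N ℕ.≤-refl i₀)))

    coef-sum : sum (λ ℓ → a (Fin.toℕ ℓ) (Fin.toℕ<n ℓ)) ≡ s
    coef-sum = begin
      Σa                ≡⟨ sym (ℚ.+-identityˡ Σa) ⟩
      0ℚ ℚ.+ Σa         ≡⟨ cong (ℚ._+ Σa) (sym (ℚ.+-inverseʳ s)) ⟩
      -- The telescoping quantity is `s - remaining k`, which grows by `a k` at step `k`.
      s ℚ.- s ℚ.+ Σa    ≡⟨ sym (telescope N a (λ k k≤N → s ℚ.- remaining k k≤N) λ k k<N →
                             solve 3 (λ s x a → s :- (x :- a) := s :- x :+ a) refl
                               s (remaining k (ℕ.<⇒≤ k<N)) (a k k<N)) ⟩
      s ℚ.- r           ≡⟨ cong (λ x → s ℚ.- x) remaining≡0 ⟩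
      s ℚ.- 0ℚ          ≡⟨ solve 1 (λ s → s :- con 0ℚ := s) refl s ⟩
      s                 ∎
      where
      open ≡-Reasoning
      Σa = sum (λ ℓ → a (Fin.toℕ ℓ) (Fin.toℕ<n ℓ))

    -- The final residual has non-negative entries and line sums at most 0, so every entry is 0.
    partial-exhausts : ∀ i j → partial P A t N ℕ.≤-refl i j ≡ seq (A i j) t
    partial-exhausts i j = trans
      (solve 2 (λ x p → p := x :- (x :- p)) refl (seq (A i j) t) (partial P A t N ℕ.≤-refl i j))
      (trans (cong (λ x → seq (A i j) t ℚ.- x) R≡0)
        (solve 1 (λ x → x :- con 0ℚ := x) refl (seq (A i j) t)))
      where
      R≡0 : R N ℕ.≤-refl i j ≡ 0ℚ
      R≡0 = ℚ.≤-antisym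
        (ℚ.≤-trans (term≤sum (residual-nonNeg N ℕ.≤-refl i) j)
          (ℚ.≤-trans (ℚ.≤-reflexive (proj₁ (residual-lineSums N ℕ.≤-refl) i)) remaining≤0))
        (residual-nonNeg N ℕ.≤-refl i j)

  positive-count : (S : Subset N) → (∀ ℓ → ℓ ∈ S → 0ℚ ℚ.< a (Fin.toℕ ℓ) (Fin.toℕ<n ℓ)) →
                   ∣ S ∣ ℕ.≤ n ℕ.* n ∸ n ℕ.+ 1
  positive-count S 0<a = ℕ.≤-trans
    (subset-countdown S (λ k k≤N → support (R k k≤N)) n
      (λ k k<N → support-mono (residual-suc-≤ k k<N)) strict cap)
    (ℕ.≤-trans (ℕ.∸-monoˡ-≤ n (ℕ.s≤s (support≤n*n (R 0 ℕ.z≤n))))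
      -- Moving the 1 out of the truncated difference uses `n ≤ n * n`.
      (ℕ.≤-reflexive (trans (ℕ.+-∸-assoc 1 (n≤n*n i₀)) (ℕ.+-comm 1 (n ℕ.* n ∸ n)))))
    where
    n≤n*n : ∀ {n} → Fin n → n ℕ.≤ n ℕ.* n
    n≤n*n {suc n} _ = ℕ.m≤m*n (suc n) (suc n)
    strict : ∀ ℓ → ℓ ∈ S → support (R (suc (Fin.toℕ ℓ)) (Fin.toℕ<n ℓ)) ℕ.<
                           support (R (Fin.toℕ ℓ) (ℕ.<⇒≤ (Fin.toℕ<n ℓ)))
    strict ℓ ℓ∈S with coef-attained P A t (Fin.toℕ ℓ) (Fin.toℕ<n ℓ) i₀
    ... | i , e = ℕ.≤-<-trans
      (support-mono (λ i j → ℚ.≤-reflexive (residual-suc P A t (Fin.toℕ ℓ) (Fin.toℕ<n ℓ) i j)))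
      (support-subtract (R (Fin.toℕ ℓ) (ℕ.<⇒≤ (Fin.toℕ<n ℓ))) (a (Fin.toℕ ℓ) (Fin.toℕ<n ℓ))
        (P (Fin.fromℕ< (Fin.toℕ<n ℓ))) (0<a ℓ ℓ∈S) i e)
    -- A positive minimum makes all `n` entries on the permutation positive.
    cap : ∀ ℓ → ℓ ∈ S → n ℕ.≤ support (R (Fin.toℕ ℓ) (ℕ.<⇒≤ (Fin.toℕ<n ℓ)))
    cap ℓ ℓ∈S = n≤support (R (Fin.toℕ ℓ) (ℕ.<⇒≤ (Fin.toℕ<n ℓ))) (P (Fin.fromℕ< (Fin.toℕ<n ℓ)))
      (λ i → ℚ.<-≤-trans (0<a ℓ ℓ∈S) (coef-≤ P A t (Fin.toℕ ℓ) (Fin.toℕ<n ℓ) i))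

-- Lipschitz estimates

-- Two linear inequalities in place of an absolute value, so that monotonicity and ring identities
-- suffice.
Within : ℚ → ℚ → ℚ → Set
Within d p q = p ℚ.≤ q ℚ.+ d × q ℚ.≤ p ℚ.+ d

within-sym : ∀ {d p q} → Within d p q → Within d q p
within-sym (h , k) = k , h

within-weaken : ∀ {d e p q} → d ℚ.≤ e → Within d p q → Within e p q
within-weaken {p = p} {q} d≤e (h , k) =
  ℚ.≤-trans h (ℚ.+-monoʳ-≤ q d≤e) , ℚ.≤-trans k (ℚ.+-monoʳ-≤ p d≤e)

within-trans : ∀ {d e p q r} → Within d p q → Within e q r → Within (d ℚ.+ e) p r
within-trans {d} {e} {p} {q} {r} (h , h′) (k , k′) =
  ℚ.≤-trans (ℚ.≤-trans h (ℚ.+-monoˡ-≤ d k))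
    (ℚ.≤-reflexive (solve 3 (λ r d e → r :+ e :+ d := r :+ (d :+ e)) refl r d e)) ,
  ℚ.≤-trans (ℚ.≤-trans k′ (ℚ.+-monoˡ-≤ e h′)) (ℚ.≤-reflexive (ℚ.+-assoc p d e))

within-+ : ∀ {d e p q r s} → Within d p q → Within e r s → Within (d ℚ.+ e) (p ℚ.+ r) (q ℚ.+ s)
within-+ {d} {e} {p} {q} {r} {s} (h , h′) (k , k′) =
  ℚ.≤-trans (ℚ.+-mono-≤ h k) (ℚ.≤-reflexive (interchange q s)) ,
  ℚ.≤-trans (ℚ.+-mono-≤ h′ k′) (ℚ.≤-reflexive (interchange p r))
  where
  interchange : ∀ x y → x ℚ.+ d ℚ.+ (y ℚ.+ e) ≡ x ℚ.+ y ℚ.+ (d ℚ.+ e)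
  interchange x y = solve 4 (λ x y d e → x :+ d :+ (y :+ e) := x :+ y :+ (d :+ e)) refl x y d e

within-neg : ∀ {d p q} → Within d p q → Within d (ℚ.- p) (ℚ.- q)
within-neg {d} {p} {q} (h , k) =
  ≤-from-gap _ (gap k) (solve 3 (λ p q d → :- p :+ (p :+ d :- q) := :- q :+ d) refl p q d) ,
  ≤-from-gap _ (gap h) (solve 3 (λ p q d → :- q :+ (q :+ d :- p) := :- p :+ d) refl p q d)

within-sub : ∀ {d e p q r s} → Within d p q → Within e r s → Within (d ℚ.+ e) (p ℚ.- r) (q ℚ.- s)
within-sub h k = within-+ h (within-neg k)

within⇒∣-∣< : ∀ {d ε p q} → Within d p q → d ℚ.< ε → ℚ.∣ p ℚ.- q ∣ ℚ.< ε
within⇒∣-∣< {p = p} {q} (h , k) d<ε =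
  <⇒∣-∣< (ℚ.≤-<-trans h (ℚ.+-monoʳ-< q d<ε)) (ℚ.≤-<-trans k (ℚ.+-monoʳ-< p d<ε))

∣-∣<⇒within : ∀ {d p q} → ℚ.∣ p ℚ.- q ∣ ℚ.< d → Within d p q
∣-∣<⇒within {d} {p} {q} h = ℚ.<⇒≤ (∣-∣<⇒< p q h) ,
  ℚ.<⇒≤ (∣-∣<⇒< q p (subst (ℚ._< d) (∣-∣-comm p q) h))

-- The rational number `n`, in the form that arises from summing a constant.
size : ℕ → ℚ
size n = sum {n} (λ _ → 1ℚ)

0≤size : ∀ n → 0ℚ ℚ.≤ size n
0≤size n = sum-nonNeg {n} (λ _ → 0≤1)

sum-const : ∀ n d → sum {n} (λ _ → d) ≡ size n ℚ.* d
sum-const n d = trans (sum-cong-≗ {n} (λ _ → sym (ℚ.*-identityˡ d))) (sym (*-distribʳ-sum {n} d (λ _ → 1ℚ)))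

within-sum : ∀ {n d} {f g : Fin n → ℚ} → (∀ i → Within d (f i) (g i)) →
             Within (size n ℚ.* d) (sum f) (sum g)
within-sum {n} {d} {f} {g} h = bound f g (proj₁ ∘ h) , bound g f (proj₂ ∘ h)
  where
  bound : ∀ f g → (∀ i → f i ℚ.≤ g i ℚ.+ d) → sum f ℚ.≤ sum g ℚ.+ size n ℚ.* d
  bound f g h = ℚ.≤-trans (sum-mono h) (ℚ.≤-reflexive
    (trans (∑-distrib-+ g (λ _ → d)) (cong (sum g ℚ.+_) (sum-const n d))))

-- Both bounds are convex combinations: y * g + e - x * g = (y + e - x) * g + e * (1 - g).
within-*-unit : ∀ {e x y g} → 0ℚ ℚ.≤ e → 0ℚ ℚ.≤ g → g ℚ.≤ 1ℚ → Within e x y →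
                Within e (x ℚ.* g) (y ℚ.* g)
within-*-unit {e} {x} {y} {g} 0≤e 0≤g g≤1 (h , k) = bound x y h , bound y x k
  where
  bound : ∀ x y → x ℚ.≤ y ℚ.+ e → x ℚ.* g ℚ.≤ y ℚ.* g ℚ.+ e
  bound x y h = ≤-from-gap _ (0≤+ (0≤* (gap h) 0≤g) (0≤* 0≤e (gap g≤1)))
    (solve 4 (λ e x y g → x :* g :+ ((y :+ e :- x) :* g :+ e :* (con 1ℚ :- g)) := y :* g :+ e)
      refl e x y g)

within-difference : ∀ {d p q} → Within d p q → Within d (p ℚ.- q) 0ℚ
within-difference {d} {p} {q} (h , k) =
  ≤-from-gap _ (gap h) (solve 3 (λ p q d → p :- q :+ (q :+ d :- p) := con 0ℚ :+ d) refl p q d) ,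
  ≤-from-gap _ (gap k) (solve 3 (λ p q d → con 0ℚ :+ (p :+ d :- q) := p :- q :+ d) refl p q d)

-- Lipschitz constant, in the maximum norm, of the k-th partial sum; that of the k-th
-- coefficient is 1ℚ + lipschitz k.
lipschitz : ℕ → ℚ
lipschitz zero    = 0ℚ
lipschitz (suc k) = lipschitz k ℚ.+ (1ℚ ℚ.+ lipschitz k)

lipschitz-nonNeg : ∀ k → 0ℚ ℚ.≤ lipschitz k
lipschitz-nonNeg zero    = ℚ.≤-refl
lipschitz-nonNeg (suc k) = 0≤+ (lipschitz-nonNeg k) (0≤+ 0≤1 (lipschitz-nonNeg k))

-- Gives all coefficients one common constant, `lipschitz N`.
1+lipschitz≤ : ∀ {k m} → k ℕ.< m → 1ℚ ℚ.+ lipschitz k ℚ.≤ lipschitz m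
1+lipschitz≤ {k} {suc m} (ℕ.s≤s k≤m) with ℕ.m≤n⇒m<n∨m≡n k≤m
... | inj₂ refl = ≤-from-gap _ (lipschitz-nonNeg k) (ℚ.+-comm (1ℚ ℚ.+ lipschitz k) (lipschitz k))
... | inj₁ k<m  = ℚ.≤-trans (1+lipschitz≤ k<m)
  (≤-from-gap _ (0≤+ 0≤1 (lipschitz-nonNeg m)) refl)

module _ {n N} (P : Fin N → Permutation′ n) (i₀ : Fin n) (A B : Matrix n) (t u : ℕ) {d}
         (0≤d : 0ℚ ℚ.≤ d) (A≈B : ∀ i j → Within d (seq (A i j) t) (seq (B i j) u)) where

  -- The terms `t` and `u` may differ: the Lipschitz property takes them equal, while the comparison
  -- with a constant rational matrix takes `u = 0`.
  partial-within : ∀ k .(k≤N : k ℕ.≤ N) i j →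
    Within (lipschitz k ℚ.* d) (partial P A t k k≤N i j) (partial P B u k k≤N i j)
  -- Each minimum is bounded by its own family at the position where the other minimum is attained.
  coefAt-within : ∀ k .(k<N : k ℕ.< N) →
    Within (d ℚ.+ lipschitz k ℚ.* d) (coef P A t k k<N) (coef P B u k k<N)

  partial-within zero    _   i j = bound , bound
    where
    bound : 0ℚ ℚ.≤ 0ℚ ℚ.+ 0ℚ ℚ.* d
    bound = ℚ.≤-reflexive (solve 1 (λ d → con 0ℚ := con 0ℚ :+ con 0ℚ :* d) refl d)
  partial-within (suc k) k<N i j = subst₂ (Within (lipschitz (suc k) ℚ.* d))
    (sym (partial-suc P A t k k<N i j)) (sym (partial-suc P B u k k<N i j))
    (subst (λ e → Within e _ _)
      (solve 2 (λ l d → l :* d :+ (d :+ l :* d) := (l :+ (con 1ℚ :+ l)) :* d) refl (lipschitz k) d)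
      (within-+ (partial-within k (ℕ.<⇒≤ k<N) i j) term))
    where
    π = P (Fin.fromℕ< k<N)
    e = d ℚ.+ lipschitz k ℚ.* d
    0≤e : 0ℚ ℚ.≤ e
    0≤e = 0≤+ 0≤d (0≤* (lipschitz-nonNeg k) 0≤d)
    term : Within e (coef P A t k k<N ℚ.* δ π i j) (coef P B u k k<N ℚ.* δ π i j)
    term = within-*-unit 0≤e (δ-nonNeg π i j) (δ≤1 π i j) (coefAt-within k k<N)

  coefAt-within k k<N = compare (coef-attained P A t k k<N i₀) (coef-attained P B u k k<N i₀)
    where
    open ℚ.≤-Reasoning
    π = P (Fin.fromℕ< k<N)
    e = d ℚ.+ lipschitz k ℚ.* d
    residual-within : ∀ i j → Within e (residual P A t k (ℕ.<⇒≤ k<N) i j) (residual P B u k (ℕ.<⇒≤ k<N) i j)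
    residual-within i j = within-sub (A≈B i j) (partial-within k (ℕ.<⇒≤ k<N) i j)
    compare : (∃ λ i → coef P A t k k<N ≡ residual P A t k (ℕ.<⇒≤ k<N) i (π ⟨$⟩ʳ i)) →
              (∃ λ i → coef P B u k k<N ≡ residual P B u k (ℕ.<⇒≤ k<N) i (π ⟨$⟩ʳ i)) →
              Within e (coef P A t k k<N) (coef P B u k k<N)
    compare (i , a≡) (j , b≡) =
      (begin
        coef P A t k k<N                                      ≤⟨ coef-≤ P A t k k<N j ⟩
        residual P A t k (ℕ.<⇒≤ k<N) j (π ⟨$⟩ʳ j)             ≤⟨ proj₁ (residual-within j (π ⟨$⟩ʳ j)) ⟩
        residual P B u k (ℕ.<⇒≤ k<N) j (π ⟨$⟩ʳ j) ℚ.+ e       ≡⟨ cong (ℚ._+ e) (sym b≡) ⟩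
        coef P B u k k<N ℚ.+ e                                ∎) ,
      (begin
        coef P B u k k<N                                      ≤⟨ coef-≤ P B u k k<N i ⟩
        residual P B u k (ℕ.<⇒≤ k<N) i (π ⟨$⟩ʳ i)             ≤⟨ proj₂ (residual-within i (π ⟨$⟩ʳ i)) ⟩
        residual P A t k (ℕ.<⇒≤ k<N) i (π ⟨$⟩ʳ i) ℚ.+ e       ≡⟨ cong (ℚ._+ e) (sym a≡) ⟩
        coef P A t k k<N ℚ.+ e                                ∎)

  coefficient-within : ∀ ℓ → Within (lipschitz N ℚ.* d) (seq (coefficient P A ℓ) t) (seq (coefficient P B ℓ) u)
  coefficient-within ℓ = within-weaken
    (ℚ.≤-trans
      (ℚ.≤-reflexive (solve 2 (λ l d → d :+ l :* d := (con 1ℚ :+ l) :* d) refl (lipschitz (Fin.toℕ ℓ)) d))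
      (ℚ.*-monoʳ-≤-nonNeg d {{ℚ.nonNegative 0≤d}} (1+lipschitz≤ (Fin.toℕ<n ℓ))))
    (coefAt-within (Fin.toℕ ℓ) (Fin.toℕ<n ℓ))

-- Repairing almost doubly stochastic matrices

within-shift : ∀ p {e} → 0ℚ ℚ.≤ e → Within e (p ℚ.+ e) p
within-shift p {e} 0≤e = ℚ.≤-refl , ≤-from-gap (e ℚ.+ e) (0≤+ 0≤e 0≤e) (sym (ℚ.+-assoc p e e))

within-perturb : ∀ p {x d} → Within d x 0ℚ → Within d (p ℚ.+ x) p
within-perturb p {x} {d} (h , k) =
  ≤-from-gap _ (gap h) (solve 3 (λ p x d → p :+ x :+ (con 0ℚ :+ d :- x) := p :+ d) refl p x d) ,
  ≤-from-gap _ k (sym (ℚ.+-assoc p x d))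

-- The line sum may differ slightly from 1, which leaves room for a uniform upward shift.
ExactNearby : ∀ {n} → ℚ → Matrixℚ n → Set
ExactNearby {n} d M = ∃ λ (B : Matrixℚ n) → ∃ λ s → NonNegative B × LineSums B s ×
  (∀ i j → Within d (M i j) (B i j)) × Within d s 1ℚ

-- In units of `η`: the correction is at most `θ`, the shift is `1 + θ`, and it changes line sums by
-- `size n * (1 + θ)`. The total bounds the deviation of entries and of line sums alike.
repairFactor : ℕ → ℚ
repairFactor n = θ ℚ.+ (1ℚ ℚ.+ θ) ℚ.+ size n ℚ.* (1ℚ ℚ.+ θ)
  where θ = 1ℚ ℚ.+ 1ℚ ℚ.+ size n

module Repair {n} (i₀ : Fin n) (M : Matrixℚ n) {η} (0≤η : 0ℚ ℚ.≤ η)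
              (0≤M+η : ∀ i j → 0ℚ ℚ.≤ M i j ℚ.+ η)
              (rows : ∀ i → Within η (sum (M i)) 1ℚ)
              (columns : ∀ j → Within η (sum (λ i → M i j)) 1ℚ) where

  private
    g e f : Fin n → ℚ
    -- `g` is the unit vector at `i₀`; `e` and `f` are the deficits of the rows and columns.
    g = δ Permutation.id i₀
    e i = 1ℚ ℚ.- sum (M i)
    f j = 1ℚ ℚ.- sum (λ i → M i j)

    E : ℚ
    E = sum e

    -- Both totals are `size n` minus the sum of all entries.
    Σf≡E : sum f ≡ E
    Σf≡E = trans (sum-sub (λ _ → 1ℚ) (λ j → sum (λ i → M i j)))
      (trans (cong (λ x → size n ℚ.- x) (sym (∑-comm M))) (sym (sum-sub (λ _ → 1ℚ) (λ i → sum (M i)))))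

    Σg≡1 : sum g ≡ 1ℚ
    Σg≡1 = proj₁ (δ-lineSums Permutation.id) i₀

    0≤g : ∀ j → 0ℚ ℚ.≤ g j
    0≤g = δ-nonNeg Permutation.id i₀

    g≤1 : ∀ j → g j ℚ.≤ 1ℚ
    g≤1 = δ≤1 Permutation.id i₀

    -- Adding it makes all line sums equal to 1, but may create negative entries; the
    -- constant shift removes these.
    correction : Matrixℚ n
    correction i j = e i ℚ.* g j ℚ.+ f j ℚ.* g i ℚ.- E ℚ.* g i ℚ.* g j

    θ shift : ℚ
    θ = η ℚ.+ η ℚ.+ size n ℚ.* η
    shift = η ℚ.+ θ

    0≤θ : 0ℚ ℚ.≤ θ
    0≤θ = 0≤+ (0≤+ 0≤η 0≤η) (0≤* (0≤size n) 0≤η)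

    0≤shift : 0ℚ ℚ.≤ shift
    0≤shift = 0≤+ 0≤η 0≤θ

    *g-within : ∀ {x d} j → 0ℚ ℚ.≤ d → Within d x 0ℚ → Within d (x ℚ.* g j) 0ℚ
    *g-within {x} {d} j 0≤d h = subst (Within d (x ℚ.* g j)) (ℚ.*-zeroˡ (g j))
      (within-*-unit 0≤d (0≤g j) (g≤1 j) h)

    E-within : Within (size n ℚ.* η) E 0ℚ
    E-within = subst (Within (size n ℚ.* η) E) (sum-replicate-zero n)
      (within-sum λ i → within-difference (within-sym (rows i)))

    correction-within : ∀ i j → Within θ (correction i j) 0ℚ
    correction-within i j = within-sub
      (within-+ (*g-within j 0≤η (within-difference (within-sym (rows i))))
                (*g-within i 0≤η (within-difference (within-sym (columns j)))))
      (*g-within j (0≤* (0≤size n) 0≤η) (*g-within i (0≤* (0≤size n) 0≤η) E-within))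

    sum-*g : ∀ x → sum (λ j → x ℚ.* g j) ≡ x
    sum-*g x = trans (sym (*-distribˡ-sum x g)) (trans (cong (x ℚ.*_) Σg≡1) (ℚ.*-identityʳ x))

    -- One computation for rows and columns, whose roles in the correction are symmetric. The line
    -- receives its own deficit `x`; the deficits `h` of the crossing lines contribute `E * y`,
    -- which the last term cancels.
    sum-corrected : ∀ (m h : Fin n → ℚ) x y → sum h ≡ E → x ≡ 1ℚ ℚ.- sum m →
      sum (λ j → m j ℚ.+ (x ℚ.* g j ℚ.+ h j ℚ.* y ℚ.- E ℚ.* y ℚ.* g j) ℚ.+ shift) ≡
      1ℚ ℚ.+ size n ℚ.* shift
    sum-corrected m h x y Σh≡E refl = begin
      sum (λ j → m j ℚ.+ (x ℚ.* g j ℚ.+ h j ℚ.* y ℚ.- E ℚ.* y ℚ.* g j) ℚ.+ shift)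
        ≡⟨ ∑-distrib-+ (λ j → m j ℚ.+ (x ℚ.* g j ℚ.+ h j ℚ.* y ℚ.- E ℚ.* y ℚ.* g j)) (λ _ → shift) ⟩
      sum (λ j → m j ℚ.+ (x ℚ.* g j ℚ.+ h j ℚ.* y ℚ.- E ℚ.* y ℚ.* g j)) ℚ.+ sum {n} (λ _ → shift)
        ≡⟨ cong₂ ℚ._+_ (∑-distrib-+ m (λ j → x ℚ.* g j ℚ.+ h j ℚ.* y ℚ.- E ℚ.* y ℚ.* g j)) (sum-const n shift) ⟩
      sum m ℚ.+ sum (λ j → x ℚ.* g j ℚ.+ h j ℚ.* y ℚ.- E ℚ.* y ℚ.* g j) ℚ.+ size n ℚ.* shift
        ≡⟨ cong (λ z → sum m ℚ.+ z ℚ.+ size n ℚ.* shift) (trans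
             (sum-sub (λ j → x ℚ.* g j ℚ.+ h j ℚ.* y) (λ j → E ℚ.* y ℚ.* g j))
             (cong₂ ℚ._-_
               (trans (∑-distrib-+ (λ j → x ℚ.* g j) (λ j → h j ℚ.* y))
                 (cong₂ ℚ._+_ (sum-*g x) (trans (sym (*-distribʳ-sum y h)) (cong (ℚ._* y) Σh≡E))))
               (sum-*g (E ℚ.* y)))) ⟩
      sum m ℚ.+ (x ℚ.+ E ℚ.* y ℚ.- E ℚ.* y) ℚ.+ size n ℚ.* shift
        ≡⟨ solve 3 (λ r z w → r :+ (con 1ℚ :- r :+ z :- z) :+ w := con 1ℚ :+ w) refl
             (sum m) (E ℚ.* y) (size n ℚ.* shift) ⟩
      1ℚ ℚ.+ size n ℚ.* shift ∎
      where open ≡-Reasoning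

  repaired : Matrixℚ n
  repaired i j = M i j ℚ.+ correction i j ℚ.+ shift

  repaired-nonNeg : NonNegative repaired
  repaired-nonNeg i j = ℚ.≤-trans
    (0≤+ (0≤M+η i j) (proj₂ (correction-within i j)))
    (ℚ.≤-reflexive (solve 4 (λ m c η θ → m :+ η :+ (c :+ θ) := m :+ c :+ (η :+ θ)) refl
      (M i j) (correction i j) η θ))

  repaired-lineSums : LineSums repaired (1ℚ ℚ.+ size n ℚ.* shift)
  repaired-lineSums =
    (λ i → sum-corrected (M i) f (e i) (g i) Σf≡E refl) ,
    (λ j → trans
      (sum-cong-≗ λ i → solve 7 (λ m x g h y E s → m :+ (x :* g :+ h :* y :- E :* y :* g) :+ s :=
                                  m :+ (h :* y :+ x :* g :- E :* g :* y) :+ s) refl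
        (M i j) (e i) (g j) (f j) (g i) E shift)
      (sum-corrected (λ i → M i j) e (f j) (g j) refl refl))

  repaired-within : ∀ i j → Within (repairFactor n ℚ.* η) (M i j) (repaired i j)
  repaired-within i j = within-sym (within-weaken
    (≤-from-gap _ (0≤* (0≤size n) 0≤shift)
      (solve 2 (λ ν η → let θ = η :+ η :+ ν :* η ; t = con 1ℚ :+ con 1ℚ :+ ν in
        η :+ θ :+ θ :+ ν :* (η :+ θ) :=
        (t :+ (con 1ℚ :+ t) :+ ν :* (con 1ℚ :+ t)) :* η) refl (size n) η))
    (within-trans (within-shift (M i j ℚ.+ correction i j) 0≤shift)
      (within-perturb (M i j) (correction-within i j))))

  repaired-lineSum-within : Within (repairFactor n ℚ.* η) (1ℚ ℚ.+ size n ℚ.* shift) 1ℚ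
  repaired-lineSum-within = within-weaken
    (≤-from-gap _ (0≤+ 0≤θ 0≤shift)
      (solve 2 (λ ν η → let θ = η :+ η :+ ν :* η ; t = con 1ℚ :+ con 1ℚ :+ ν in
        ν :* (η :+ θ) :+ (θ :+ (η :+ θ)) :=
        (t :+ (con 1ℚ :+ t) :+ ν :* (con 1ℚ :+ t)) :* η) refl (size n) η))
    (within-shift 1ℚ (0≤* (0≤size n) 0≤shift))

  exactNearby : ExactNearby (repairFactor n ℚ.* η) M
  exactNearby = repaired , 1ℚ ℚ.+ size n ℚ.* shift , repaired-nonNeg , repaired-lineSums ,
    repaired-within , repaired-lineSum-within

-- Passage to the reals

Eventually : (ℕ → Set) → Set
Eventually Q = ∃ λ N → ∀ t → N ℕ.≤ t → Q t

eventually-map : ∀ {Q R : ℕ → Set} → (∀ t → Q t → R t) → Eventually Q → Eventually R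
eventually-map f (N , h) = N , λ t N≤t → f t (h t N≤t)

eventually-× : ∀ {Q R : ℕ → Set} → Eventually Q → Eventually R → Eventually (λ t → Q t × R t)
eventually-× (M , h) (N , k) = M ℕ.⊔ N , λ t le →
  h t (ℕ.m⊔n≤o⇒m≤o M N le) , k t (ℕ.m⊔n≤o⇒n≤o M N le)

eventually-∀ : ∀ {n} {Q : Fin n → ℕ → Set} → (∀ i → Eventually (Q i)) → Eventually (λ t → ∀ i → Q i t)
eventually-∀ {zero}  h = 0 , λ _ _ ()
eventually-∀ {suc n} h = eventually-map (λ { t (q , qs) → λ { zero → q ; (suc i) → qs i } })
  (eventually-× (h zero) (eventually-∀ (h ∘ suc)))

-- The modulus is taken at `1 + c`, which is positive even for `c = 0`.
scaleBelow : ∀ {c ε} → 0ℚ ℚ.≤ c → 0ℚ ℚ.< ε → ∃ λ d → 0ℚ ℚ.< d × c ℚ.* d ℚ.< ε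
scaleBelow {c} {ε} 0≤c 0<ε = d , 0<d , (begin-strict
  c ℚ.* d                               ≤⟨ ≤-from-gap _ (0≤+ (ℚ.<⇒≤ 0<d) (0≤* (ℚ.<⇒≤ 0<d) (ℚ.<⇒≤ 0<1+c)))
                                             (solve 2 (λ c d → c :* d :+ (d :+ d :* (con 1ℚ :+ c)) :=
                                               d :* (con 1ℚ :+ c) :+ d :* (con 1ℚ :+ c)) refl c d) ⟩
  d ℚ.* (1ℚ ℚ.+ c) ℚ.+ d ℚ.* (1ℚ ℚ.+ c) <⟨ *-modulus-< ε 0<ε 0<1+c ⟩
  ε                                     ∎)
  where
  open ℚ.≤-Reasoning
  0<1+c : 0ℚ ℚ.< 1ℚ ℚ.+ c
  0<1+c = ℚ.+-mono-<-≤ 0<1 0≤c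
  d = *-modulus ε 0<ε 0<1+c
  0<d : 0ℚ ℚ.< d
  0<d = *-modulus-pos ε 0<ε 0<1+c

repairFactor-nonNeg : ∀ n → 0ℚ ℚ.≤ repairFactor n
repairFactor-nonNeg n = 0≤+ (0≤+ 0≤θ 0≤1+θ) (0≤* (0≤size n) 0≤1+θ)
  where
  0≤θ : 0ℚ ℚ.≤ 1ℚ ℚ.+ 1ℚ ℚ.+ size n
  0≤θ = 0≤+ (0≤+ 0≤1 0≤1) (0≤size n)
  0≤1+θ : 0ℚ ℚ.≤ 1ℚ ℚ.+ (1ℚ ℚ.+ 1ℚ ℚ.+ size n)
  0≤1+θ = 0≤+ 0≤1 0≤θ

-- Double stochasticity is a finite list of limit conditions, so from some term on all hold up to
-- `η`, and that term can be repaired.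
eventually-exactNearby : ∀ {n} → Fin n → (A : 𝒟 n) → ∀ {d} → 0ℚ ℚ.< d →
                         Eventually λ t → ExactNearby d (λ i j → seq (proj₁ A i j) t)
eventually-exactNearby {n} i₀ (A , ds) {d} 0<d = eventually-map repair
  (eventually-× (eventually-∀ λ i → eventually-∀ λ j → nonNegative i j η 0<η)
    (eventually-× (eventually-∀ λ i → rowSum i η 0<η) (eventually-∀ λ j → columnSum j η 0<η)))
  where
  open DoublyStochastic ds
  chosen : ∃ λ η → 0ℚ ℚ.< η × repairFactor n ℚ.* η ℚ.< d
  chosen = scaleBelow (repairFactor-nonNeg n) 0<d
  η : ℚ
  η = proj₁ chosen
  0<η : 0ℚ ℚ.< η
  0<η = proj₁ (proj₂ chosen)
  repair : ∀ t → (∀ i j → 0ℚ ℚ.< seq (A i j) t ℚ.+ η) ×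
             (∀ i → ℚ.∣ seq (∑ (λ j → A i j)) t ℚ.- 1ℚ ∣ ℚ.< η) ×
             (∀ j → ℚ.∣ seq (∑ (λ i → A i j)) t ℚ.- 1ℚ ∣ ℚ.< η) →
           ExactNearby d (λ i j → seq (A i j) t)
  repair t (0<A+η , rows , columns) =
    let module M = Repair i₀ (λ i j → seq (A i j) t) (ℚ.<⇒≤ 0<η) (λ i j → ℚ.<⇒≤ (0<A+η i j))
          (λ i → subst (λ x → Within η x 1ℚ) (seq-∑ (A i) t) (∣-∣<⇒within (rows i)))
          (λ j → subst (λ x → Within η x 1ℚ) (seq-∑ (λ i → A i j) t) (∣-∣<⇒within (columns j)))
        B , s , 0≤B , lines , A≈B , s≈1 = M.exactNearby
        cη≤d = ℚ.<⇒≤ (proj₂ (proj₂ chosen))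
    in B , s , 0≤B , lines , (λ i j → within-weaken cη≤d (A≈B i j)) , within-weaken cη≤d s≈1

fromℚ : ℚ → ℝ
fromℚ q = mkℝ (λ _ → q) (fromℚ-cauchy q)

0≤fromℚ : ∀ {q} → 0ℚ ℚ.≤ q → 0ℝ ≤ fromℚ q
0≤fromℚ 0≤q ε 0<ε = 0 , λ _ _ → ℚ.+-mono-≤-< 0≤q 0<ε

²<²⇒≤ : ∀ {x y} → 0ℚ ℚ.≤ y → x ℚ.* x ℚ.< y ℚ.* y → x ℚ.≤ y
²<²⇒≤ {x} {y} 0≤y x²<y² = ℚ.≮⇒≥ λ y<x → ℚ.<-irrefl refl (ℚ.<-≤-trans x²<y²
  (*-mono-≤-nonNeg 0≤y (ℚ.≤-trans 0≤y (ℚ.<⇒≤ y<x)) (ℚ.<⇒≤ y<x) (ℚ.<⇒≤ y<x)))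

0≤² : ∀ x → 0ℚ ℚ.≤ x ℚ.* x
0≤² x with ℚ.≤-total 0ℚ x
... | inj₁ 0≤x = 0≤* 0≤x 0≤x
... | inj₂ x≤0 = subst (0ℚ ℚ.≤_) (solve 1 (λ x → (con 0ℚ :- x) :* (con 0ℚ :- x) := x :* x) refl x)
  (0≤* (gap x≤0) (gap x≤0))

module _ {n} (A B : Matrix n) where

  squaredDistance : ℝ
  squaredDistance = ∑ λ i → ∑ λ j → (A i j - B i j) * (A i j - B i j)

  -- The squared difference is one summand of the squared distance, which lies below the square of
  -- `root + width`.
  entry-within : ∀ t i j → Within
    (seq (distance A B) t ℚ.+ width (seq squaredDistance t ℚ.⊔ 0ℚ) t) (seq (A i j) t) (seq (B i j) t)
  entry-within t i j = bound , subst₂ ℚ._≤_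
      (solve 2 (λ a b → a :+ (b :- a) := b) refl (seq (A i j) t) (seq (B i j) t)) refl
      (ℚ.+-monoʳ-≤ (seq (A i j) t) (²<²⇒≤ 0≤r (subst (ℚ._< r ℚ.* r)
        (solve 2 (λ a b → (a :- b) :* (a :- b) := (b :- a) :* (b :- a)) refl (seq (A i j) t) (seq (B i j) t))
        x²<r²)))
    where
    x q r : ℚ
    x = seq (A i j) t ℚ.- seq (B i j) t
    q = seq squaredDistance t ℚ.⊔ 0ℚ
    r = root q t ℚ.+ width q t
    0≤q : 0ℚ ℚ.≤ q
    0≤q = ℚ.p≤q⊔p (seq squaredDistance t) 0ℚ
    0≤r : 0ℚ ℚ.≤ r
    0≤r = 0≤+ (root-nonNeg 0≤q t) (ℚ.<⇒≤ (width-pos 0≤q t))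
    sq : Matrixℚ n
    sq i j = seq ((A i j - B i j) * (A i j - B i j)) t
    0≤sq : NonNegative sq
    0≤sq i j = 0≤² (seq (A i j) t ℚ.- seq (B i j) t)
    x²<r² : x ℚ.* x ℚ.< r ℚ.* r
    x²<r² = begin-strict
      sq i j                            ≤⟨ term≤sum (0≤sq i) j ⟩
      sum (sq i)                        ≤⟨ term≤sum (λ i → sum-nonNeg (0≤sq i)) i ⟩
      sum (λ i → sum (sq i))            ≡⟨ sum-cong-≗ (λ i → sym (seq-∑ (λ j → (A i j - B i j) * (A i j - B i j)) t)) ⟩
      sum (λ i → seq (∑ λ j → (A i j - B i j) * (A i j - B i j)) t)
                                        ≡⟨ sym (seq-∑ (λ i → ∑ λ j → (A i j - B i j) * (A i j - B i j)) t) ⟩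
      seq squaredDistance t             ≤⟨ ℚ.p≤p⊔q (seq squaredDistance t) 0ℚ ⟩
      q                                 <⟨ <[root+width]² 0≤q t ⟩
      r ℚ.* r                           ∎
      where open ℚ.≤-Reasoning
    bound : seq (A i j) t ℚ.≤ seq (B i j) t ℚ.+ r
    bound = subst₂ ℚ._≤_
      (solve 2 (λ a b → b :+ (a :- b) := a) refl (seq (A i j) t) (seq (B i j) t)) refl
      (ℚ.+-monoʳ-≤ (seq (B i j) t) (²<²⇒≤ 0≤r x²<r²))

  -- The squared distance is a Cauchy sequence, hence bounded, and `width` multiplies it by `½^ t`.
  width-vanishes : ∀ {c ε} → 0ℚ ℚ.≤ c → 0ℚ ℚ.< ε →
    Eventually λ t → c ℚ.* width (seq squaredDistance t ℚ.⊔ 0ℚ) t ℚ.< ε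
  width-vanishes {c} {ε} 0≤c 0<ε = vanishes
      (bounded (seq squaredDistance) (seq squaredDistance) (cauchy squaredDistance) (cauchy squaredDistance))
    where
    q : ℕ → ℚ
    q t = seq squaredDistance t
    vanishes : (∃ λ b → 0ℚ ℚ.< b × Eventually λ t → ℚ.∣ q t ∣ ℚ.≤ b × ℚ.∣ q t ∣ ℚ.≤ b) →
               Eventually λ t → c ℚ.* width (q t ℚ.⊔ 0ℚ) t ℚ.< ε
    vanishes (b , 0<b , ev) = eventually-map small
      (eventually-× ev (½^-small ((1ℚ ℚ.+ c) ℚ.* (1ℚ ℚ.+ b))
        (*-pos (ℚ.+-mono-<-≤ 0<1 0≤c) (ℚ.+-mono-< 0<1 0<b)) 0<ε))
      where
      open ℚ.≤-Reasoning
      small : ∀ t → (ℚ.∣ q t ∣ ℚ.≤ b × ℚ.∣ q t ∣ ℚ.≤ b) × (1ℚ ℚ.+ c) ℚ.* (1ℚ ℚ.+ b) ℚ.* ½^ t ℚ.< ε →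
              c ℚ.* width (q t ℚ.⊔ 0ℚ) t ℚ.< ε
      small t ((q≤b , _) , lt) = begin-strict
        c ℚ.* ((1ℚ ℚ.+ (q t ℚ.⊔ 0ℚ)) ℚ.* ½^ t)
          ≤⟨ ≤-from-gap _ (0≤+ (0≤* 0≤c (0≤* (gap q⁺≤b) 0≤½)) (0≤* (0≤+ 0≤1 (ℚ.<⇒≤ 0<b)) 0≤½))
               (solve 4 (λ c q b h → c :* ((con 1ℚ :+ q) :* h) :+ (c :* ((b :- q) :* h) :+ (con 1ℚ :+ b) :* h) :=
                  (con 1ℚ :+ c) :* (con 1ℚ :+ b) :* h) refl c (q t ℚ.⊔ 0ℚ) b (½^ t)) ⟩
        (1ℚ ℚ.+ c) ℚ.* (1ℚ ℚ.+ b) ℚ.* ½^ t   <⟨ lt ⟩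
        ε                                    ∎
        where
        0≤½ : 0ℚ ℚ.≤ ½^ t
        0≤½ = ℚ.<⇒≤ (½^-pos t)
        q⁺≤b : q t ℚ.⊔ 0ℚ ℚ.≤ b
        q⁺≤b = ℚ.⊔-lub (ℚ.≤-trans (≤∣∣ (q t)) q≤b) (ℚ.<⇒≤ 0<b)
          where
          ≤∣∣ : ∀ p → p ℚ.≤ ℚ.∣ p ∣
          ≤∣∣ p = [ (λ 0≤p → ℚ.≤-reflexive (sym (ℚ.0≤p⇒∣p∣≡p 0≤p))) , (λ p≤0 → ℚ.≤-trans p≤0 (ℚ.0≤∣p∣ p)) ]′
            (ℚ.≤-total 0ℚ p)

-- One index m serves as bound and as starting point, so that the condition passes to
-- larger m and finitely many such m can be merged.
Apart : ℝ → Set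
Apart x = Eventually λ m → ∀ t → m ℕ.≤ t → ½^ m ℚ.< seq x t

-- Take `N` beyond which terms differ by less than `ε / 4`. If term `N` were at least `ε / 2`, later
-- terms would exceed `ε / 4` and `x` would be `Apart`. Hence it is smaller, by decidability of the
-- rational order, and later terms stay below `ε`.
nonNeg∧¬apart⇒≈0 : ∀ x → 0ℝ ≤ x → ¬ Apart x → x ≈ 0ℝ
nonNeg∧¬apart⇒≈0 x 0≤x ¬apart ε 0<ε = eventually-map
    (λ t (0<x+ε , x<ε) → <⇒∣-∣< (subst (seq x t ℚ.<_) (sym (ℚ.+-identityˡ ε)) x<ε) 0<x+ε)
    (eventually-× (0≤x ε 0<ε) (N , below))
  where
  open ℚ.≤-Reasoning
  δ′ η : ℚ
  δ′ = ε ℚ.* ½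
  η = δ′ ℚ.* ½
  0<δ′ : 0ℚ ℚ.< δ′
  0<δ′ = half-pos 0<ε
  0<η : 0ℚ ℚ.< η
  0<η = half-pos 0<δ′
  N : ℕ
  N = proj₁ (cauchy x η 0<η)
  close : ∀ s t → N ℕ.≤ s → N ℕ.≤ t → seq x s ℚ.< seq x t ℚ.+ η
  close s t N≤s N≤t = ∣-∣<⇒< (seq x s) (seq x t) (proj₂ (cauchy x η 0<η) s t N≤s N≤t)
  xN<δ′ : seq x N ℚ.< δ′
  xN<δ′ = ℚ.≰⇒> λ δ′≤xN → ¬apart (eventually-map
    (λ m (N≤m , ½<η) t m≤t → begin-strict
      ½^ m                  ≡⟨ sym (ℚ.*-identityˡ (½^ m)) ⟩
      1ℚ ℚ.* ½^ m           <⟨ ½<η ⟩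
      η                     ≡⟨ solve 1 (λ d → d :* con ½ := d :- d :* con ½) refl δ′ ⟩
      δ′ ℚ.- η              ≤⟨ ℚ.+-monoˡ-≤ (ℚ.- η) δ′≤xN ⟩
      seq x N ℚ.- η         <⟨ ℚ.+-monoˡ-< (ℚ.- η) (close N t ℕ.≤-refl (ℕ.≤-trans N≤m m≤t)) ⟩
      seq x t ℚ.+ η ℚ.- η   ≡⟨ solve 2 (λ x e → x :+ e :- e := x) refl (seq x t) η ⟩
      seq x t               ∎)
    (eventually-× (N , λ _ N≤m → N≤m) (½^-small 1ℚ 0<1 0<η)))
  below : ∀ t → N ℕ.≤ t → seq x t ℚ.< ε
  below t N≤t = begin-strict
    seq x t          <⟨ close t N N≤t ℕ.≤-refl ⟩
    seq x N ℚ.+ η    <⟨ ℚ.+-monoˡ-< η xN<δ′ ⟩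
    δ′ ℚ.+ η         <⟨ <-from-gap η 0<η (trans (ℚ.+-assoc δ′ η η) (cong (δ′ ℚ.+_) (half+half δ′))) ⟩
    δ′ ℚ.+ δ′        ≡⟨ half+half ε ⟩
    ε                ∎

-- The decomposition of a real doubly stochastic matrix

module Decomposition {n N} (i₀ : Fin n) (P : Fin N → Permutation′ n) where

  private
    Λ : ℚ
    Λ = lipschitz N
    0≤Λ : 0ℚ ℚ.≤ Λ
    0≤Λ = lipschitz-nonNeg N

  -- The constant for the maximum norm also serves for the larger Euclidean norm; `ε` absorbs the
  -- error `width` of the approximate root.
  coefficient-lipschitz : ∀ ℓ → LipschitzContinuous {n} (λ A → coefficient P (proj₁ A) ℓ)
  coefficient-lipschitz ℓ = fromℚ Λ , 0≤fromℚ 0≤Λ , λ (A , _) (B , _) ε 0<ε →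
    eventually-map (bound A B) (width-vanishes A B 0≤Λ 0<ε)
    where
    bound : ∀ A B {ε} t → Λ ℚ.* width (seq (squaredDistance A B) t ℚ.⊔ 0ℚ) t ℚ.< ε →
      ℚ.∣ seq (coefficient P A ℓ) t ℚ.- seq (coefficient P B ℓ) t ∣ ℚ.< Λ ℚ.* seq (distance A B) t ℚ.+ ε
    bound A B {ε} t small = within⇒∣-∣<
      (coefficient-within P i₀ A B t t 0≤d (entry-within A B t) ℓ)
      (subst (ℚ._< Λ ℚ.* seq (distance A B) t ℚ.+ ε)
        (sym (ℚ.*-distribˡ-+ Λ (seq (distance A B) t) (width q t)))
        (ℚ.+-monoʳ-< (Λ ℚ.* seq (distance A B) t) small))
      where
      q : ℚ
      q = seq (squaredDistance A B) t ℚ.⊔ 0ℚ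
      0≤q : 0ℚ ℚ.≤ q
      0≤q = ℚ.p≤q⊔p (seq (squaredDistance A B) t) 0ℚ
      0≤d : 0ℚ ℚ.≤ seq (distance A B) t ℚ.+ width q t
      0≤d = 0≤+ (root-nonNeg 0≤q t) (ℚ.<⇒≤ (width-pos 0≤q t))

  module _ (A : 𝒟 n) where

    private
      α : Fin N → ℝ
      α = coefficient P (proj₁ A)

    -- An exact matrix near term `t` of `A`. Embedded by constant sequences, it has its rational
    -- recursion at term 0.
    record Approximation (d : ℚ) (t : ℕ) : Set where
      field
        matrix      : Matrixℚ n
        lineSum     : ℚ
        0≤matrix    : NonNegative matrix
        lines       : LineSums matrix lineSum
        nearby      : ∀ i j → Within d (seq (proj₁ A i j) t) (matrix i j)
        nearby-sum  : Within d lineSum 1ℚ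
        0≤d         : 0ℚ ℚ.≤ d

      realMatrix : Matrix n
      realMatrix i j = fromℚ (matrix i j)

      module E = Exact P realMatrix 0 i₀ 0≤matrix lines

      β : Fin N → ℚ
      β ℓ = seq (coefficient P realMatrix ℓ) 0

      α≈β : ∀ ℓ → Within (Λ ℚ.* d) (seq (α ℓ) t) (β ℓ)
      α≈β = coefficient-within P i₀ (proj₁ A) realMatrix t 0 0≤d nearby

      partial≈ : ∀ i j → Within (Λ ℚ.* d) (partial P (proj₁ A) t N ℕ.≤-refl i j)
                                          (partial P realMatrix 0 N ℕ.≤-refl i j)
      partial≈ = partial-within P i₀ (proj₁ A) realMatrix t 0 0≤d nearby N ℕ.≤-refl

    approximation : ∀ {d} → 0ℚ ℚ.< d → Eventually (Approximation d)
    approximation 0<d = eventually-map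
      (λ t (B , s , 0≤B , lines , A≈B , s≈1) → record
        { matrix = B ; lineSum = s ; 0≤matrix = 0≤B ; lines = lines
        ; nearby = A≈B ; nearby-sum = s≈1 ; 0≤d = ℚ.<⇒≤ 0<d })
      (eventually-exactNearby i₀ A 0<d)

    approximation-below : ∀ {c ε} → 0ℚ ℚ.≤ c → 0ℚ ℚ.< ε →
      ∃ λ d → c ℚ.* d ℚ.< ε × Eventually (Approximation d)
    approximation-below 0≤c 0<ε =
      let d , 0<d , cd<ε = scaleBelow 0≤c 0<ε in d , cd<ε , approximation 0<d

    coefficient-nonNeg : ∀ ℓ → 0ℝ ≤ α ℓ
    coefficient-nonNeg ℓ ε 0<ε =
      let d , Λd<ε , ev = approximation-below 0≤Λ 0<ε in
      eventually-map (λ t X → let open Approximation X in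
        ℚ.≤-<-trans (E.coef-nonNeg (Fin.toℕ ℓ) (Fin.toℕ<n ℓ))
          (ℚ.≤-<-trans (proj₂ (α≈β ℓ)) (ℚ.+-monoʳ-< (seq (α ℓ) t) Λd<ε))) ev

    module _ (covers : ∀ π → ∃ λ ℓ → ∀ i → P ℓ ⟨$⟩ʳ i ≡ π ⟨$⟩ʳ i) where

      coefficient-sum : ∑ α ≈ 1ℝ
      coefficient-sum ε 0<ε =
        -- `size N * Λ` covers the deviations of the coefficients, and 1 that of the line sum.
        let d , cd<ε , ev = approximation-below {c = size N ℚ.* Λ ℚ.+ 1ℚ} (0≤+ (0≤* (0≤size N) 0≤Λ) 0≤1) 0<ε in
        eventually-map (λ t X → let open Approximation X in
          within⇒∣-∣<
            (subst (λ x → Within (size N ℚ.* (Λ ℚ.* d) ℚ.+ d) x 1ℚ) (sym (seq-∑ α t))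
              (within-trans (within-sum α≈β)
                (subst (λ x → Within d x 1ℚ) (sym (E.coef-sum covers)) nearby-sum)))
            (subst (ℚ._< ε) (solve 3 (λ ν l d → (ν :* l :+ con 1ℚ) :* d := ν :* (l :* d) :+ d) refl
              (size N) Λ d) cd<ε)) ev

      -- Holds exactly at every term: the partial sums telescope to the sum over `Fin N`.
      seq-decomposition : ∀ i j t →
        seq (∑ (λ ℓ → α ℓ * permutationMatrix (P ℓ) i j)) t ≡ partial P (proj₁ A) t N ℕ.≤-refl i j
      seq-decomposition i j t = trans (seq-∑ (λ ℓ → α ℓ * permutationMatrix (P ℓ) i j) t)
        (trans (sum-cong-≗ λ ℓ → cong (seq (α ℓ) t ℚ.*_)
            (trans (seq-permutationMatrix (P ℓ) i j t)
              (cong (λ ℓ → δ (P ℓ) i j) (sym (Fin.fromℕ<-toℕ ℓ (Fin.toℕ<n ℓ))))))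
          (sym (trans
            (telescope N (λ k k<N → coef P (proj₁ A) t k k<N ℚ.* δ (P (Fin.fromℕ< k<N)) i j)
              (λ k k≤N → partial P (proj₁ A) t k k≤N i j) (λ k k<N → partial-suc P (proj₁ A) t k k<N i j))
            (ℚ.+-identityˡ _))))

      decomposition : ∀ i j → proj₁ A i j ≈ ∑ (λ ℓ → α ℓ * permutationMatrix (P ℓ) i j)
      decomposition i j ε 0<ε =
        -- 1 covers the deviation of the entry, and `Λ` that of the partial sum.
        let d , cd<ε , ev = approximation-below {c = 1ℚ ℚ.+ Λ} (0≤+ 0≤1 0≤Λ) 0<ε in
        eventually-map (λ t X → let open Approximation X in
          within⇒∣-∣<
            (subst (Within (d ℚ.+ Λ ℚ.* d) (seq (proj₁ A i j) t)) (sym (seq-decomposition i j t))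
              (within-trans (nearby i j)
                (subst (λ x → Within (Λ ℚ.* d) x (partial P (proj₁ A) t N ℕ.≤-refl i j))
                  (E.partial-exhausts covers i j) (within-sym (partial≈ i j)))))
            (subst (ℚ._< ε) (solve 2 (λ l d → (con 1ℚ :+ l) :* d := d :+ l :* d) refl Λ d) cd<ε)) ev

    -- The bound is decidable, so it may be proved under a double negation. There the finitely many
    -- nonzero coefficients in `S` can all be taken `Apart`.
    nonzero-count : AtMost (n ℕ.* n ∸ n ℕ.+ 1) (λ ℓ → ¬ (α ℓ ≈ 0ℝ))
    nonzero-count S nonzero = decidable-stable (_ ℕ.≤? _)
      (¬¬-map count (Fin.sequence (RawMonad.rawApplicative ¬¬-Monad) apart))
      where
      LargeAt : Fin N → ℕ → Set
      LargeAt ℓ m = ℓ ∈ S → ∀ t → m ℕ.≤ t → ½^ m ℚ.< seq (α ℓ) t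

      apart : ∀ ℓ → ¬ ¬ Eventually (LargeAt ℓ)
      apart ℓ ¬large with ℓ ∈? S
      ... | no  ℓ∉S = ¬large (0 , λ _ _ ℓ∈S → ⊥-elim (ℓ∉S ℓ∈S))
      ... | yes ℓ∈S = nonzero ℓ ℓ∈S (nonNeg∧¬apart⇒≈0 (α ℓ) (coefficient-nonNeg ℓ)
        λ x → ¬large (eventually-map (λ _ h _ → h) x))

      count : (∀ ℓ → Eventually (LargeAt ℓ)) → ∣ S ∣ ℕ.≤ n ℕ.* n ∸ n ℕ.+ 1
      count large =
        let m , large-m = eventually-∀ large
            -- With this tolerance, a coefficient above `½^ m` at term `t` has a positive exact
            -- counterpart.
            d , Λd<½ , N′ , approx = approximation-below 0≤Λ (½^-pos m)
            t = m ℕ.⊔ N′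
            open Approximation (approx t (ℕ.m≤n⊔m m N′))
        in E.positive-count S λ ℓ ℓ∈S → ℚ.≰⇒> λ β≤0 → ℚ.<-irrefl refl (ℚ.<-trans
          (ℚ.<-≤-trans (large-m m ℕ.≤-refl ℓ ℓ∈S t (ℕ.m≤m⊔n m N′))
            (ℚ.≤-trans (proj₁ (α≈β ℓ)) (ℚ.≤-trans (ℚ.+-monoˡ-≤ (Λ ℚ.* d) β≤0)
              (ℚ.≤-reflexive (ℚ.+-identityˡ (Λ ℚ.* d))))))
          Λd<½)

theorem2p4 : (n : ℕ) → 1 ℕ.≤ n → (P : Fin (n !) → Permutation.Permutation′ n) →
    Bijective _≡_ Permutation._≈_ P →
    (∀ ℓ → LipschitzContinuous {n} (λ A → coefficient P (proj₁ A) ℓ))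
    × (∀ (A : 𝒟 n) → (∀ ℓ → 0ℝ ≤ coefficient P (proj₁ A) ℓ)
    × ∑ (λ ℓ → coefficient P (proj₁ A) ℓ) ≈ 1ℝ)
    × (∀ (A : 𝒟 n) → ∀ i j →
    proj₁ A i j ≈ ∑ (λ ℓ → coefficient P (proj₁ A) ℓ * permutationMatrix (P ℓ) i j))
    × (∀ (A : 𝒟 n) →
    AtMost (n ℕ.* n ∸ n ℕ.+ 1) (λ ℓ → ¬ (coefficient P (proj₁ A) ℓ ≈ 0ℝ)))
theorem2p4 (suc n) _ P (_ , surjective) =
    coefficient-lipschitz ,
    (λ A → coefficient-nonNeg A , coefficient-sum A covers) ,
    (λ A → decomposition A covers) ,
    nonzero-count
  where
  -- `zero` is the index that keeps every list `ones` nonempty.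
  open Decomposition {suc n} zero P
  covers : ∀ π → ∃ λ ℓ → ∀ i → P ℓ ⟨$⟩ʳ i ≡ π ⟨$⟩ʳ i
  covers π = proj₁ (surjective π) , proj₂ (surjective π) refl
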